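{- Let $\chi_1,\chi_2$ be nontrivial primitive Dirichlet characters of respective conductors $q_1,q_2$ with $\chi_1\chi_2(-1)=1$. Then \[ S_{\chi_1,\chi_2}(\Gamma_1(q_1q_2)) \subseteq \frac{1}{\gcd(q_1,q_2)}\,\mathbb{Z}[\chi_1,\chi_2]. \]
   Context: $B_1(x)=0$ if $x\in\mathbb{Z}$ and $B_1(x)=x-\lfloor x\rfloor-\tfrac12$ otherwise. $\Gamma_0(N)$ is the group of matrices $\begin{pmatrix}a&b\\c&d\end{pmatrix}\in SL_2(\mathbb{Z})$ with $N\mid c$, and $\Gamma_1(N)$ the subgroup with additionally $a\equiv d\equiv 1 \pmod N$. For $\gamma=\begin{pmatrix}a&b\\c&d\end{pmatrix}\in\Gamma_0(q_1q_2)$ with $c\ge 1$, the newform Dedekind sum is \[S_{\chi_1,\chi_2}(\gamma)=S_{\chi_1,\chi_2}(a,c)=\sum_{j \bmod c}\ \sum_{n \bmod q_1}\overline{\chi_2}(j)\overline{\chi_1}(n)B_1\Big(\frac{j}{c}\Big)B_1\Big(\frac{n}{q_1}+\frac{aj}{c}\Big);\] it is extended to all of $\Gamma_0(q_1q_2)$ by $S_{\chi_1,\chi_2}(\gamma)=0$ if $c=0$ and $S_{\chi_1,\chi_2}(\gamma)=S_{\chi_1,\chi_2}(-\gamma)$ if $c<0$ (this is the map arising from newform Eisenstein series, which satisfies $S(\gamma_1\gamma_2)=S(\gamma_1)+\chi_1\overline{\chi_2}(d_1)S(\gamma_2)$ where $d_1$ is the lower-right entry of $\gamma_1$). $F_{\chi_1,\chi_2}$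 denotes the smallest number field containing all values of $\chi_1$ and $\chi_2$, and $\mathbb{Z}[\chi_1,\chi_2]$ denotes the ring of integers of $F_{\chi_1,\chi_2}$. -}

module Defs where

open import Level using (Level; _⊔_) renaming (suc to lsuc)
open import Algebra.Bundles using (CommutativeRing)
open import Data.Nat as ℕ using (ℕ; zero; suc)
import Data.Nat.GCD as ℕG
open import Data.Integer as ℤ using (ℤ; +_; -[1+_]; ∣_∣)
open import Data.Integer.DivMod using (_%ℕ_)
open import Data.Integer.Divisibility using (_∣_)
open import Data.List using (List; []; _∷_; length; upTo)
open import Data.Product using (∃; Σ; _×_; _,_)
open import Relation.Binary.PropositionalEquality using (_≡_; _≢_)
open import Relation.Nullary using (¬_; yes; no)

-- Fields of characteristic 0 (the values of Dirichlet characters live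
-- in such a field, e.g. ℂ or the number field F_{χ1,χ2} itself).

module _ {c ℓ : Level} (R : CommutativeRing c ℓ) where
  open CommutativeRing R

  fromℕ : ℕ → Carrier
  fromℕ zero    = 0#
  fromℕ (suc n) = 1# + fromℕ n

  fromℤ : ℤ → Carrier
  fromℤ (+ n)     = fromℕ n
  fromℤ -[1+ n ]  = - fromℕ (suc n)

  pow : Carrier → ℕ → Carrier
  pow x zero    = 1#
  pow x (suc n) = x * pow x n

record Char0Field (c ℓ : Level) : Set (lsuc (c ⊔ ℓ)) where
  field
    cring : CommutativeRing c ℓ
  open CommutativeRing cring
  field
    _⁻¹       : Carrier → Carrier
    ⁻¹-inverse : ∀ x → ¬ (x ≈ 0#) → (x * (x ⁻¹)) ≈ 1#
    1≉0       : ¬ (1# ≈ 0#)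
    char0     : ∀ n → ¬ (fromℕ cring (suc n) ≈ 0#)

module _ {c ℓ : Level} (K : Char0Field c ℓ) where
  open Char0Field K
  open CommutativeRing cring

  Coprime : ℤ → ℕ → Set
  Coprime n q = ℕG.gcd ∣ n ∣ q ≡ 1

  record IsDirichletChar (q : ℕ) (χ : ℤ → Carrier) : Set (c ⊔ ℓ) where
    field
      modulus-pos : 1 ℕ.≤ q
      periodic    : ∀ n → χ (n ℤ.+ + q) ≈ χ n
      mult        : ∀ m n → χ (m ℤ.* n) ≈ (χ m * χ n)
      one         : χ (+ 1) ≈ 1#
      nonunit     : ∀ n → ¬ Coprime n q → χ n ≈ 0#
      unit        : ∀ n → Coprime n q → ¬ (χ n ≈ 0#)

  -- χ mod q is primitive (i.e. has conductor q): for no proper divisor d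
  -- of q is χ induced from a character mod d, i.e. for every divisor
  -- d ∣ q with d < q there is n coprime to q with n ≡ 1 (mod d), χ(n) ≠ 1.
  IsPrimitive : (q : ℕ) → (ℤ → Carrier) → Set ℓ
  IsPrimitive q χ = ∀ d → (+ d) ∣ (+ q) → d ℕ.< q →
    ∃ λ n → Coprime n q × ((+ d) ∣ (n ℤ.- + 1)) × ¬ (χ n ≈ 1#)

  IsNontrivial : (q : ℕ) → (ℤ → Carrier) → Set ℓ
  IsNontrivial q χ = ∃ λ n → Coprime n q × ¬ (χ n ≈ 1#)

  -- Conjugate character: on values (roots of unity) conjugation is
  -- inversion; zero on non-units.
  conjChar : ℕ → (ℤ → Carrier) → ℤ → Carrier
  conjChar q χ n with ℕG.gcd ∣ n ∣ q ℕ.≟ 1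
  ... | yes _ = (χ n) ⁻¹
  ... | no  _ = 0#

  -- B₁(r/m) for r ∈ ℤ, m ≥ 1, as an element of K:
  -- 0 if m ∣ r, and (r mod m)/m − 1/2 = (2(r mod m) − m)/(2m) otherwise.
  B1 : ℤ → ℕ → Carrier
  B1 r zero = 0#
  B1 r (suc k) with r %ℕ (suc k)
  ... | zero  = 0#
  ... | suc s = fromℤ cring ((+ (2 ℕ.* suc s)) ℤ.- + (suc k))
                * (fromℕ cring (2 ℕ.* suc k)) ⁻¹

  sumK : List ℕ → (ℕ → Carrier) → Carrier
  sumK []       f = 0#
  sumK (x ∷ xs) f = f x + sumK xs f

  -- S_{χ1,χ2}(a, c) for c ≥ 1:
  -- Σ_{j mod c} Σ_{n mod q1} χ̄2(j) χ̄1(n) B₁(j/c) B₁(n/q1 + aj/c),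
  -- with n/q1 + aj/c = (n c + a j q1)/(q1 c).
  Sac : (q1 q2 : ℕ) (χ1 χ2 : ℤ → Carrier) → ℤ → ℕ → Carrier
  Sac q1 q2 χ1 χ2 a c =
    sumK (upTo c) λ j → sumK (upTo q1) λ n →
      conjChar q2 χ2 (+ j) * conjChar q1 χ1 (+ n) * B1 (+ j) c
        * B1 ((+ n) ℤ.* (+ c) ℤ.+ a ℤ.* (+ j) ℤ.* (+ q1)) (q1 ℕ.* c)

  -- S_{χ1,χ2}(γ) for γ = (a b ; c d): 0 if c = 0, S(a,c) if c > 0,
  -- S(−γ) = S(−a,−c) if c < 0.
  Sγ : (q1 q2 : ℕ) (χ1 χ2 : ℤ → Carrier) → (a b c d : ℤ) → Carrier
  Sγ q1 q2 χ1 χ2 a b (+ zero)   d = 0#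
  Sγ q1 q2 χ1 χ2 a b (+ suc k)  d = Sac q1 q2 χ1 χ2 a (suc k)
  Sγ q1 q2 χ1 χ2 a b -[1+ k ]   d = Sac q1 q2 χ1 χ2 (ℤ.- a) (suc k)

  evalPoly : List ℤ → Carrier → Carrier
  evalPoly []       x = 0#
  evalPoly (a ∷ as) x = fromℤ cring a + x * evalPoly as x

  IsAlgebraicInteger : Carrier → Set ℓ
  IsAlgebraicInteger x =
    ∃ λ (cs : List ℤ) → (pow cring x (length cs) + evalPoly cs x) ≈ 0#

InΓ₁ : ℕ → (a b c d : ℤ) → Set
InΓ₁ N a b c d =
  (a ℤ.* d ℤ.- b ℤ.* c ≡ + 1) × ((+ N) ∣ c)
  × ((+ N) ∣ (a ℤ.- + 1)) × ((+ N) ∣ (d ℤ.- + 1))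

{-# OPTIONS --safe #-}
module Submission where

-- Put c = m, m₁ = m / q₁, ψᵢ = χ̄ᵢ, and for x = a j + m₁ n write x = r + m fl
-- with 0 ≤ r < m. Let ⟪z⟫ denote the sum of ψ₂(j) ψ₁(n) z(j, n) over j mod m and
-- n mod q₁. It kills every function of j alone, of n alone, or of r alone (for
-- fixed n the map j ↦ r is a permutation under which ψ₂(j) only changes by a
-- constant), so the parity condition gives m² S = ⟪j r⟫. Summing
-- 2 a j r = (a j)² + r² − (m fl − m₁ n)², where ⟪fl⟫ = 0 and fl² ≡ fl mod 2,
-- expresses a S through the integral sum ⟪(fl² − fl)/2⟫ and ⟪fl·n⟫ / q₁; the
-- latter is an integral multiple of Σ j ψ₂(j) · Σ n ψ₁(n) because
-- a ≡ ±1 mod q₁ q₂. So a S and m² S are integral, and hence S is, as a and m are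
-- coprime.
-- Elements stabilising the ℤ-span of the products ψ₁(i) ψ₂(j) are algebraic
-- integers by an elimination argument.

open import Defs
open import Level using (Level; _⊔_)
open import Algebra.Bundles using (CommutativeRing)
import Algebra.Properties.Ring
import Algebra.Properties.Semiring.Mult
import Algebra.Properties.Semiring.Sum
import Algebra.Solver.Ring
open import Algebra.Solver.Ring.AlmostCommutativeRing using (_-Raw-AlmostCommutative⟶_; fromCommutativeRing)
open import Data.Fin as Fin using (Fin; toℕ; fromℕ<; combine; remainder)
open import Data.Fin.Permutation using (Permutation; permutation; _⟨$⟩ʳ_)
import Data.Fin.Properties as Fin
open import Data.Integer as ℤ using (ℤ; +_; -[1+_]; ∣_∣)
open import Data.Integer.DivMod using (_%ℕ_; _/ℕ_; n%ℕd<d; a≡a%ℕn+[a/ℕn]*n)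
import Data.Integer.Divisibility.Signed as Signed
import Data.Integer.Properties as ℤ
open import Data.Integer.Tactic.RingSolver using (solve-∀)
open import Data.List using (List; []; _∷_; length; upTo; applyUpTo)
import Data.Maybe as Maybe
open import Data.Nat as ℕ using (ℕ; zero; suc)
import Data.Nat.Divisibility as ℕ
open import Data.Nat.GCD as ℕ using (gcd; gcd-GCD; module Bézout)
import Data.Nat.Properties as ℕ
open import Data.Product using (∃; _×_; _,_; proj₁; proj₂)
open import Function using (_∘_; id)
open import Relation.Binary.PropositionalEquality as ≡ using (_≡_)
import Relation.Binary.Reasoning.Setoid as SetoidReasoning
open import Relation.Nullary using (¬_; Dec; yes; no; contradiction)
open import Relation.Nullary.Decidable using (dec⇒maybe)

-- Closure of the algebraic integers under sums and products is a theorem of its own, so they are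
-- never added or multiplied here. Integrality is carried by a property closed for formal reasons,
-- that of mapping one fixed lattice into itself; it is turned into a monic equation only once, at
-- the end. Identities with denominators are proved after multiplication by a nonzero integer, which
-- characteristic 0 allows to cancel. Two multiples of S are needed because each leaves a
-- denominator that the other does not: polarisation reaches S only through a S, clearing the
-- denominators of B₁ only through m² S. The 1/q₁ attached to ⟪fl·n⟫ does no harm because Σ j ψ₂(j)
-- over j mod m consists of m / q₂ equal periods, and q₁ divides that number. The sign in a ≡ ±1
-- comes from negative c, where the sum is evaluated at -γ.

infix 4 _≅_[_]

-- Congruences, least residues and affine permutations of residues.

record _≅_[_] (x y : ℤ) (c : ℕ) : Set where
  constructor _,_
  field
    quotient : ℤ
    -- Solved for `x`, so that matching with `refl` eliminates `x` and each rule below becomes a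
    -- polynomial identity for the ring solver.
    equation : x ≡ y ℤ.+ quotient ℤ.* + c

≅-refl : ∀ {x c} → x ≅ x [ c ]
≅-refl {x} {c} = + 0 , lemma x (+ c)
  where
  lemma : ∀ x c → x ≡ x ℤ.+ + 0 ℤ.* c
  lemma = solve-∀

≅-sym : ∀ {x y c} → x ≅ y [ c ] → y ≅ x [ c ]
≅-sym {_} {y} {c} (q , ≡.refl) = ℤ.- q , lemma y q (+ c)
  where
  lemma : ∀ y q c → y ≡ y ℤ.+ q ℤ.* c ℤ.+ ℤ.- q ℤ.* c
  lemma = solve-∀

≅-trans : ∀ {x y z c} → x ≅ y [ c ] → y ≅ z [ c ] → x ≅ z [ c ]
≅-trans {z = z} {c} (q , ≡.refl) (q′ , ≡.refl) = q ℤ.+ q′ , lemma z q q′ (+ c)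
  where
  lemma : ∀ z q q′ c → z ℤ.+ q′ ℤ.* c ℤ.+ q ℤ.* c ≡ z ℤ.+ (q ℤ.+ q′) ℤ.* c
  lemma = solve-∀

≅-+ : ∀ {x y x′ y′ c} → x ≅ y [ c ] → x′ ≅ y′ [ c ] → x ℤ.+ x′ ≅ y ℤ.+ y′ [ c ]
≅-+ {y = y} {y′ = y′} {c} (q , ≡.refl) (q′ , ≡.refl) = q ℤ.+ q′ , lemma y y′ q q′ (+ c)
  where
  lemma : ∀ y y′ q q′ c → y ℤ.+ q ℤ.* c ℤ.+ (y′ ℤ.+ q′ ℤ.* c) ≡ y ℤ.+ y′ ℤ.+ (q ℤ.+ q′) ℤ.* c
  lemma = solve-∀

≅-*ˡ : ∀ k {x y c} → x ≅ y [ c ] → k ℤ.* x ≅ k ℤ.* y [ c ]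
≅-*ˡ k {y = y} {c} (q , ≡.refl) = k ℤ.* q , lemma k y q (+ c)
  where
  lemma : ∀ k y q c → k ℤ.* (y ℤ.+ q ℤ.* c) ≡ k ℤ.* y ℤ.+ k ℤ.* q ℤ.* c
  lemma = solve-∀

≅-neg : ∀ {x y c} → x ≅ y [ c ] → ℤ.- x ≅ ℤ.- y [ c ]
≅-neg {y = y} {c} (q , ≡.refl) = ℤ.- q , lemma y q (+ c)
  where
  lemma : ∀ y q c → ℤ.- (y ℤ.+ q ℤ.* c) ≡ ℤ.- y ℤ.+ ℤ.- q ℤ.* c
  lemma = solve-∀

≅-reflexive : ∀ {x y c} → x ≡ y → x ≅ y [ c ]
≅-reflexive ≡.refl = ≅-refl

≅-scale : ∀ p {x y c} → x ≅ y [ c ] → + p ℤ.* x ≅ + p ℤ.* y [ p ℕ.* c ]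
≅-scale p {y = y} {c} (q , ≡.refl) = q , ≡.trans (lemma (+ p) y q (+ c))
  (≡.cong (λ m → + p ℤ.* y ℤ.+ q ℤ.* m) (≡.sym (ℤ.pos-* p c)))
  where
  lemma : ∀ p y q c → p ℤ.* (y ℤ.+ q ℤ.* c) ≡ p ℤ.* y ℤ.+ q ℤ.* (p ℤ.* c)
  lemma = solve-∀

≅-coarsen : ∀ {x y} p c → x ≅ y [ p ℕ.* c ] → x ≅ y [ c ]
≅-coarsen {y = y} p c (q , ≡.refl) = q ℤ.* + p ,
  ≡.cong (λ z → y ℤ.+ z) (≡.trans (≡.cong (q ℤ.*_) (ℤ.pos-* p c)) (≡.sym (ℤ.*-assoc q (+ p) (+ c))))

module _ (c : ℕ) .{{_ : ℕ.NonZero c}} where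

  %ℕ-≅ : ∀ x → + (x %ℕ c) ≅ x [ c ]
  %ℕ-≅ x = ≅-sym (x /ℕ c , a≡a%ℕn+[a/ℕn]*n x c)

  residue-unique : ∀ {r s} → r ℕ.< c → s ℕ.< c → + r ≅ + s [ c ] → r ≡ s
  residue-unique {r} {s} r<c s<c (q , eq) = r≡s
    where
    diff : (r ℤ.⊖ s) ≡ q ℤ.* + c
    diff = ≡.trans (≡.sym (ℤ.m-n≡m⊖n r s)) (≡.trans (≡.cong (ℤ._- + s) eq) (lemma (+ s) q (+ c)))
      where
      lemma : ∀ s q c → s ℤ.+ q ℤ.* c ℤ.- s ≡ q ℤ.* c
      lemma = solve-∀
    abs< : ∣ r ℤ.⊖ s ∣ ℕ.< c
    abs< = ℕ.≤-<-trans (ℤ.∣m⊝n∣≤m⊔n r s) (ℕ.⊔-lub r<c s<c)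
    c∣abs : c ℕ.∣ ∣ r ℤ.⊖ s ∣
    c∣abs = ℕ.divides ∣ q ∣ (≡.trans (≡.cong ∣_∣ diff) (ℤ.abs-* q (+ c)))
    small : ∀ m → m ℕ.< c → c ℕ.∣ m → m ≡ 0
    small zero    _   _   = ≡.refl
    small (suc m) m<c c∣m = contradiction c∣m (ℕ.>⇒∤ m<c)
    r≡s : r ≡ s
    r≡s = ℤ.+-injective (ℤ.i-j≡0⇒i≡j (+ r) (+ s)
      (≡.trans (ℤ.m-n≡m⊖n r s) (ℤ.∣i∣≡0⇒i≡0 (small _ abs< c∣abs))))

  %ℕ-unique : ∀ {x r} → r ℕ.< c → x ≅ + r [ c ] → x %ℕ c ≡ r
  %ℕ-unique {x} r<c x≅r = residue-unique (n%ℕd<d x c) r<c (≅-trans (%ℕ-≅ x) x≅r)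

  %ℕ-cong : ∀ {x y} → x ≅ y [ c ] → x %ℕ c ≡ y %ℕ c
  %ℕ-cong {x} {y} x≅y = %ℕ-unique (n%ℕd<d y c) (≅-trans x≅y (≅-sym (%ℕ-≅ y)))

  [+m]%ℕ : ∀ {m} → m ℕ.< c → (+ m) %ℕ c ≡ m
  [+m]%ℕ m<c = %ℕ-unique m<c ≅-refl

  neg-%ℕ-zero : ∀ x → x %ℕ c ≡ 0 → (ℤ.- x) %ℕ c ≡ 0
  neg-%ℕ-zero x eq = %ℕ-unique (ℕ.n≢0⇒n>0 (ℕ.≢-nonZero⁻¹ c))
    (≅-trans (≅-neg (≅-sym (%ℕ-≅ x))) (≅-reflexive (≡.cong (λ r → ℤ.- (+ r)) eq)))

  neg-%ℕ-suc : ∀ x {s} → x %ℕ c ≡ suc s → + ((ℤ.- x) %ℕ c) ≡ + c ℤ.- + suc s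
  neg-%ℕ-suc x {s} eq = ≡.trans (≡.cong +_ (%ℕ-unique {r = c ℕ.∸ suc s} below cong)) (≡.sym pos)
    where
    s<c : suc s ℕ.< c
    s<c = ≡.subst (ℕ._< c) eq (n%ℕd<d x c)
    pos : + c ℤ.- + suc s ≡ + (c ℕ.∸ suc s)
    pos = ≡.trans (ℤ.m-n≡m⊖n c (suc s)) (ℤ.⊖-≥ (ℕ.<⇒≤ s<c))
    below : c ℕ.∸ suc s ℕ.< c
    below = ℕ.∸-monoʳ-< (ℕ.s≤s ℕ.z≤n) (ℕ.<⇒≤ s<c)
    lemma : ∀ c s → ℤ.- s ≡ c ℤ.- s ℤ.+ ℤ.- (+ 1) ℤ.* c
    lemma = solve-∀
    cong : ℤ.- x ≅ + (c ℕ.∸ suc s) [ c ]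
    cong = ≅-trans (≅-neg (≅-sym (%ℕ-≅ x)))
      (≅-trans (≅-reflexive (≡.cong (λ r → ℤ.- (+ r)) eq))
        (≅-trans (ℤ.- (+ 1) , lemma (+ c) (+ suc s)) (≅-reflexive pos)))

  -- j ↦ (a j + k) mod c, inverted by r ↦ d (r − k) mod c.
  affine : ∀ a d k → a ℤ.* d ≅ + 1 [ c ] → Permutation c c
  affine a d k ad≅1 = permutation (to a k) back to∘back back∘to
    where
    to : ℤ → ℤ → Fin c → Fin c
    to a k i = fromℕ< (n%ℕd<d (a ℤ.* + toℕ i ℤ.+ k) c)
    back : Fin c → Fin c
    back = to d (ℤ.- (d ℤ.* k))
    -- Both composites are one affine map after another, so a single argument serves twice; the
    -- inner reduction mod c is absorbed because the outer map respects congruence.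
    inverse : ∀ a k d k′ → (∀ x → a ℤ.* (d ℤ.* x ℤ.+ k′) ℤ.+ k ≅ x [ c ]) →
      ∀ i → to a k (to d k′ i) ≡ i
    inverse a k d k′ inv i = Fin.toℕ-injective
      (≡.trans (Fin.toℕ-fromℕ< _) (%ℕ-unique (Fin.toℕ<n i)
        (≅-trans (≅-+ (≅-*ˡ a (≅-trans (≅-reflexive (≡.cong +_ (Fin.toℕ-fromℕ< _))) (%ℕ-≅ _)))
                      (≅-refl {k}))
                 (inv (+ toℕ i)))))
    to∘back : ∀ i → to a k (back i) ≡ i
    to∘back = inverse a k d _ λ x → ≅-trans (≅-reflexive (lemma a d k x))
      (≅-trans (≅-+ (≅-*ˡ (x ℤ.- k) ad≅1) (≅-refl {k})) (≅-reflexive (lemma′ x k)))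
      where
      lemma : ∀ a d k x → a ℤ.* (d ℤ.* x ℤ.+ ℤ.- (d ℤ.* k)) ℤ.+ k ≡ (x ℤ.- k) ℤ.* (a ℤ.* d) ℤ.+ k
      lemma = solve-∀
      lemma′ : ∀ x k → (x ℤ.- k) ℤ.* + 1 ℤ.+ k ≡ x
      lemma′ = solve-∀
    back∘to : ∀ i → back (to a k i) ≡ i
    back∘to = inverse d _ a k λ x → ≅-trans (≅-reflexive (lemma a d k x))
      (≅-trans (≅-*ˡ x ad≅1) (≅-reflexive (ℤ.*-identityʳ x)))
      where
      lemma : ∀ a d k x → d ℤ.* (a ℤ.* x ℤ.+ k) ℤ.+ ℤ.- (d ℤ.* k) ≡ x ℤ.* (a ℤ.* d)
      lemma = solve-∀

-- Cancels the common factor q₁ in the second argument of B₁, which is written over the denominator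
-- q₁ c.
scale-%ℕ : ∀ p c .{{_ : ℕ.NonZero p}} .{{_ : ℕ.NonZero c}} .{{_ : ℕ.NonZero (p ℕ.* c)}} →
  ∀ x → (+ p ℤ.* x) %ℕ (p ℕ.* c) ≡ p ℕ.* (x %ℕ c)
scale-%ℕ p c x = %ℕ-unique (p ℕ.* c) (ℕ.*-monoʳ-< p (n%ℕd<d x c))
  (≅-trans (≅-sym (≅-scale p (%ℕ-≅ c x))) (≅-reflexive (≡.sym (ℤ.pos-* p (x %ℕ c)))))

neg : (k : ℕ) .{{_ : ℕ.NonZero k}} → ℕ → ℕ
neg k j = (ℤ.- (+ j)) %ℕ k

neg-pos : ∀ k .{{_ : ℕ.NonZero k}} {j} → suc j ℕ.< k → + neg k (suc j) ≡ + k ℤ.- + suc j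
neg-pos k {j} j<k = neg-%ℕ-suc k (+ suc j) ([+m]%ℕ k j<k)

-- The witness is i (i - 1) / 2. It absorbs the factor 2 of the polarisation identity, which would
-- otherwise give the integrality of 2 a S only.
square-parity : ∀ i → ∃ λ t → i ℤ.* i ≡ i ℤ.+ + 2 ℤ.* t
square-parity = λ { (+ m) → nonnegative m ; -[1+ m ] → negative m }
  where
  up : ∀ x t → x ℤ.* x ≡ x ℤ.+ + 2 ℤ.* t →
    (+ 1 ℤ.+ x) ℤ.* (+ 1 ℤ.+ x) ≡ + 1 ℤ.+ x ℤ.+ + 2 ℤ.* (t ℤ.+ x)
  up x t eq = ≡.trans (lemma x)
    (≡.trans (≡.cong (λ y → y ℤ.+ + 2 ℤ.* x ℤ.+ + 1) eq) (lemma′ x t))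
    where
    lemma : ∀ x → (+ 1 ℤ.+ x) ℤ.* (+ 1 ℤ.+ x) ≡ x ℤ.* x ℤ.+ + 2 ℤ.* x ℤ.+ + 1
    lemma = solve-∀
    lemma′ : ∀ x t → x ℤ.+ + 2 ℤ.* t ℤ.+ + 2 ℤ.* x ℤ.+ + 1 ≡ + 1 ℤ.+ x ℤ.+ + 2 ℤ.* (t ℤ.+ x)
    lemma′ = solve-∀
  reflect : ∀ x t → x ℤ.* x ≡ x ℤ.+ + 2 ℤ.* t → ℤ.- x ℤ.* ℤ.- x ≡ ℤ.- x ℤ.+ + 2 ℤ.* (t ℤ.+ x)
  reflect x t eq = ≡.trans (lemma x) (≡.trans eq (lemma′ x t))
    where
    lemma : ∀ x → ℤ.- x ℤ.* ℤ.- x ≡ x ℤ.* x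
    lemma = solve-∀
    lemma′ : ∀ x t → x ℤ.+ + 2 ℤ.* t ≡ ℤ.- x ℤ.+ + 2 ℤ.* (t ℤ.+ x)
    lemma′ = solve-∀
  nonnegative : ∀ m → ∃ λ t → + m ℤ.* + m ≡ + m ℤ.+ + 2 ℤ.* t
  nonnegative zero    = + 0 , ≡.refl
  nonnegative (suc m) = let t , eq = nonnegative m in t ℤ.+ + m , up (+ m) t eq
  negative : ∀ m → ∃ λ t → -[1+ m ] ℤ.* -[1+ m ] ≡ -[1+ m ] ℤ.+ + 2 ℤ.* t
  negative m = let t , eq = nonnegative (suc m) in t ℤ.+ + suc m , reflect (+ suc m) t eq

-- The ring homomorphism from ℤ and a solver with integer coefficients.

module IntegerEmbedding {c ℓ : Level} (R : CommutativeRing c ℓ) where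
  open CommutativeRing R
  open Algebra.Properties.Ring ring using (-‿distribˡ-*; -‿+-comm; -‿involutive; -0#≈0#)
  open Algebra.Properties.Semiring.Mult semiring using (×-homo-+) renaming (_×_ to _·_)
  open SetoidReasoning setoid

  κ : ℤ → Carrier
  κ = fromℤ R

  fromℕ≡·1 : ∀ n → fromℕ R n ≡ n · 1#
  fromℕ≡·1 zero    = ≡.refl
  fromℕ≡·1 (suc n) = ≡.cong (λ x → 1# + x) (fromℕ≡·1 n)

  fromℕ-+ : ∀ m n → fromℕ R (m ℕ.+ n) ≈ fromℕ R m + fromℕ R n
  fromℕ-+ m n rewrite fromℕ≡·1 (m ℕ.+ n) | fromℕ≡·1 m | fromℕ≡·1 n = ×-homo-+ 1# m n

  κ-⊖ : ∀ m n → κ (m ℤ.⊖ n) ≈ fromℕ R m - fromℕ R n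
  κ-⊖ zero    zero    = sym (-‿inverseʳ 0#)
  κ-⊖ zero    (suc n) = sym (+-identityˡ _)
  κ-⊖ (suc m) zero    = sym (trans (+-congˡ -0#≈0#) (+-identityʳ _))
  κ-⊖ (suc m) (suc n) = begin
    κ (suc m ℤ.⊖ suc n)         ≡⟨ ≡.cong κ (ℤ.[1+m]⊖[1+n]≡m⊖n m n) ⟩
    κ (m ℤ.⊖ n)                 ≈⟨ κ-⊖ m n ⟩
    x - y                       ≈⟨ +-congʳ (+-identityˡ x) ⟨
    0# + x - y                  ≈⟨ +-congʳ (+-congʳ (-‿inverseʳ 1#)) ⟨
    1# - 1# + x - y             ≈⟨ +-congʳ (trans (+-assoc 1# (- 1#) x) (trans (+-congˡ (+-comm (- 1#) x)) (sym (+-assoc 1# x (- 1#))))) ⟩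
    1# + x - 1# - y             ≈⟨ +-assoc _ _ _ ⟩
    1# + x + (- 1# - y)         ≈⟨ +-congˡ (-‿+-comm 1# y) ⟩
    1# + x - (1# + y)           ∎
    where
    x = fromℕ R m
    y = fromℕ R n

  κ-neg : ∀ i → κ (ℤ.- i) ≈ - κ i
  κ-neg (+ zero)  = sym -0#≈0#
  κ-neg (+ suc n) = refl
  κ-neg -[1+ n ]  = sym (-‿involutive _)

  κ-+ : ∀ i j → κ (i ℤ.+ j) ≈ κ i + κ j
  κ-+ (+ m)    (+ n)    = fromℕ-+ m n
  κ-+ (+ m)    -[1+ n ] = κ-⊖ m (suc n)
  κ-+ -[1+ m ] (+ n)    = trans (κ-⊖ n (suc m)) (+-comm _ _)
  κ-+ -[1+ m ] -[1+ n ] = begin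
    - fromℕ R (suc (suc (m ℕ.+ n)))   ≡⟨ ≡.cong (λ k → - fromℕ R (suc k)) (ℕ.+-suc m n) ⟨
    - fromℕ R (suc m ℕ.+ suc n)       ≈⟨ -‿cong (fromℕ-+ (suc m) (suc n)) ⟩
    - (fromℕ R (suc m) + fromℕ R (suc n)) ≈⟨ -‿+-comm _ _ ⟨
    - fromℕ R (suc m) - fromℕ R (suc n) ∎

  κ-*-nonneg : ∀ m j → κ (+ m ℤ.* j) ≈ fromℕ R m * κ j
  κ-*-nonneg zero    j = trans (reflexive (≡.cong κ (ℤ.*-zeroˡ j))) (sym (zeroˡ _))
  κ-*-nonneg (suc m) j = begin
    κ (+ suc m ℤ.* j)           ≡⟨ ≡.cong κ (ℤ.suc-* (+ m) j) ⟩
    κ (j ℤ.+ + m ℤ.* j)         ≈⟨ κ-+ j (+ m ℤ.* j) ⟩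
    κ j + κ (+ m ℤ.* j)         ≈⟨ +-cong (sym (*-identityˡ _)) (κ-*-nonneg m j) ⟩
    1# * κ j + fromℕ R m * κ j  ≈⟨ distribʳ _ _ _ ⟨
    fromℕ R (suc m) * κ j       ∎

  κ-* : ∀ i j → κ (i ℤ.* j) ≈ κ i * κ j
  κ-* (+ m)    j = κ-*-nonneg m j
  κ-* -[1+ m ] j = begin
    κ (-[1+ m ] ℤ.* j)        ≡⟨ ≡.cong κ (ℤ.neg-distribˡ-* (+ suc m) j) ⟨
    κ (ℤ.- (+ suc m ℤ.* j))   ≈⟨ κ-neg (+ suc m ℤ.* j) ⟩
    - κ (+ suc m ℤ.* j)       ≈⟨ -‿cong (κ-*-nonneg (suc m) j) ⟩
    - (fromℕ R (suc m) * κ j) ≈⟨ -‿distribˡ-* _ _ ⟩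
    - fromℕ R (suc m) * κ j   ∎

  κ-1 : κ (+ 1) ≈ 1#
  κ-1 = +-identityʳ 1#

  private
    homomorphism : ℤ.+-*-rawRing -Raw-AlmostCommutative⟶ fromCommutativeRing R
    homomorphism = record
      { ⟦_⟧ = κ ; +-homo = κ-+ ; *-homo = κ-* ; -‿homo = κ-neg ; 0-homo = refl ; 1-homo = κ-1 }

  -- Coefficients are compared in ℤ, where equality is decidable; equality in the ring itself need
  -- not be.
  module Solver = Algebra.Solver.Ring ℤ.+-*-rawRing (fromCommutativeRing R) homomorphism
    (λ i j → Maybe.map (λ eq → reflexive (≡.cong κ eq)) (dec⇒maybe (i ℤ.≟ j)))

  open Algebra.Properties.Semiring.Sum semiring public
    using (sum; sum-cong-≋; sum-replicate-zero; ∑-distrib-+; sum-permute; *-distribˡ-sum)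

-- Algebraic integers as multipliers of a finitely generated lattice.

module Integrality {c ℓ : Level} (K : Char0Field c ℓ) where
  open Char0Field K
  open CommutativeRing cring
  open IntegerEmbedding cring
  open Solver
  open SetoidReasoning setoid

  module _ (x : Carrier) where

    -- y is a polynomial in x with integer coefficients and degree below d.
    Low : ℕ → Carrier → Set (c ⊔ ℓ)
    Low zero    y = Level.Lift c (y ≈ 0#)
    Low (suc d) y = ∃ λ a → ∃ λ y′ → Low d y′ × y ≈ κ a + x * y′

    -- Polynomials occur only through their values at `x`, with the coefficients kept in the
    -- witnesses; a monic value equal to 0 is then exactly an integral equation for `x`.
    Monic : ℕ → Carrier → Set (c ⊔ ℓ)
    Monic d y = ∃ λ l → Low d l × y ≈ pow cring x d + l

    Low-resp : ∀ d {y z} → y ≈ z → Low d y → Low d z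
    Low-resp zero    y≈z (Level.lift y≈0)  = Level.lift (trans (sym y≈z) y≈0)
    Low-resp (suc d) y≈z (a , y′ , low , eq) = a , y′ , low , trans (sym y≈z) eq

    Low-0 : ∀ d → Low d 0#
    Low-0 zero    = Level.lift refl
    Low-0 (suc d) = + 0 , 0# , Low-0 d , solve 1 (λ x → con (+ 0) := con (+ 0) :+ x :* con (+ 0)) refl x

    Low-+ : ∀ d {y z} → Low d y → Low d z → Low d (y + z)
    Low-+ zero    (Level.lift y≈0) (Level.lift z≈0) = Level.lift (trans (+-cong y≈0 z≈0) (+-identityʳ 0#))
    Low-+ (suc d) (a , y , low , eq) (b , z , low′ , eq′) = a ℤ.+ b , y + z , Low-+ d low low′ ,
      trans (+-cong eq eq′) (trans
        (solve 5 (λ a b x y z → a :+ x :* y :+ (b :+ x :* z) := (a :+ b) :+ x :* (y :+ z)) refl (κ a) (κ b) x y z)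
        (+-congʳ (sym (κ-+ a b))))

    Low-κ* : ∀ d k {y} → Low d y → Low d (κ k * y)
    Low-κ* zero    k (Level.lift y≈0) = Level.lift (trans (*-congˡ y≈0) (zeroʳ _))
    Low-κ* (suc d) k (a , y , low , eq) = k ℤ.* a , κ k * y , Low-κ* d k low ,
      trans (*-congˡ eq) (trans
        (solve 4 (λ k a x y → k :* (a :+ x :* y) := k :* a :+ x :* (k :* y)) refl (κ k) (κ a) x y)
        (+-congʳ (sym (κ-* k a))))

    Low-x* : ∀ d {y} → Low d y → Low (suc d) (x * y)
    Low-x* d low = + 0 , _ , low , sym (+-identityˡ _)

    Low-suc : ∀ d {y} → Low d y → Low (suc d) y
    Low-suc zero    (Level.lift y≈0) = + 0 , 0# , Level.lift refl ,
      trans y≈0 (solve 1 (λ x → con (+ 0) := con (+ 0) :+ x :* con (+ 0)) refl x)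
    Low-suc (suc d) (a , y , low , eq) = a , y , Low-suc d low , eq

    Low-pad : ∀ d e {y} → Low e y → Low (d ℕ.+ e) y
    Low-pad zero    e low = low
    Low-pad (suc d) e low = Low-suc (d ℕ.+ e) (Low-pad d e low)

    Low-pow* : ∀ d e {y} → Low e y → Low (d ℕ.+ e) (pow cring x d * y)
    Low-pow* zero    e low = Low-resp e (sym (*-identityˡ _)) low
    Low-pow* (suc d) e low = Low-resp (suc d ℕ.+ e) (sym (*-assoc _ _ _)) (Low-x* (d ℕ.+ e) (Low-pow* d e low))

    Low-* : ∀ d e {y z} → Low d y → Low e z → Low (d ℕ.+ e) (y * z)
    Low-* zero    e (Level.lift y≈0) low′ = Low-resp e (sym (trans (*-congʳ y≈0) (zeroˡ _))) (Low-0 e)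
    Low-* (suc d) e {z = z} (a , y , low , eq) low′ = Low-resp (suc d ℕ.+ e)
      (sym (trans (*-congʳ eq) (solve 4 (λ a x y z → (a :+ x :* y) :* z := a :* z :+ x :* (y :* z)) refl (κ a) x y z)))
      (Low-+ (suc d ℕ.+ e) (Low-pad (suc d) e (Low-κ* e a low′)) (Low-x* (d ℕ.+ e) (Low-* d e low low′)))

    Low-neg : ∀ d {y} → Low d y → Low d (- y)
    Low-neg d {y} low = Low-resp d (solve 1 (λ y → con -[1+ 0 ] :* y := :- y) refl y) (Low-κ* d -[1+ 0 ] low)

    Low-κ : ∀ k → Low 1 (κ k)
    Low-κ k = k , 0# , Level.lift refl , solve 2 (λ k x → k := k :+ x :* con (+ 0)) refl (κ k) x

    pow-+ : ∀ d e → pow cring x (d ℕ.+ e) ≈ pow cring x d * pow cring x e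
    pow-+ zero    e = sym (*-identityˡ _)
    pow-+ (suc d) e = trans (*-congˡ (pow-+ d e)) (sym (*-assoc _ _ _))

    Monic-* : ∀ d e {y z} → Monic d y → Monic e z → Monic (d ℕ.+ e) (y * z)
    Monic-* d e {y} {z} (l , low , eq) (l′ , low′ , eq′) =
      X * l′ + (Y * l + l * l′) ,
      Low-+ (d ℕ.+ e) (Low-pow* d e low′)
        (Low-+ (d ℕ.+ e) (≡.subst (λ n → Low n (Y * l)) (ℕ.+-comm e d) (Low-pow* e d low)) (Low-* d e low low′)) ,
      (begin
        y * z                               ≈⟨ *-cong eq eq′ ⟩
        (X + l) * (Y + l′)                  ≈⟨ solve 4 (λ X Y l l′ → (X :+ l) :* (Y :+ l′) := X :* Y :+ (X :* l′ :+ (Y :* l :+ l :* l′))) refl X Y l l′ ⟩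
        X * Y + (X * l′ + (Y * l + l * l′)) ≈⟨ +-congʳ (pow-+ d e) ⟨
        pow cring x (d ℕ.+ e) + (X * l′ + (Y * l + l * l′)) ∎)
      where
      X = pow cring x d
      Y = pow cring x e

    Monic*Low : ∀ d e {y z} → Monic d y → Low e z → Low (d ℕ.+ e) (y * z)
    Monic*Low d e (l , low , eq) low′ = Low-resp (d ℕ.+ e) (sym (trans (*-congʳ eq) (distribʳ _ _ _)))
      (Low-+ (d ℕ.+ e) (Low-pow* d e low′) (Low-* d e low low′))

    Monic-+-Low : ∀ d {y z} → Monic d y → Low d z → Monic d (y + z)
    Monic-+-Low d (l , low , eq) low′ = _ , Low-+ d low low′ , trans (+-congʳ eq) (+-assoc _ _ _)

    Low⇒evalPoly : ∀ d {y} → Low d y → ∃ λ cs → length cs ≡ d × y ≈ evalPoly K cs x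
    Low⇒evalPoly zero    (Level.lift y≈0) = [] , ≡.refl , y≈0
    Low⇒evalPoly (suc d) (a , y , low , eq) =
      let cs , len , eq′ = Low⇒evalPoly d low
      in a ∷ cs , ≡.cong suc len , trans eq (+-congˡ (*-congˡ eq′))

    root⇒integral : ∀ d {y} → Monic d y → y ≈ 0# → IsAlgebraicInteger K x
    root⇒integral d (l , low , eq) y≈0 with Low⇒evalPoly d low
    ... | cs , ≡.refl , eq′ = cs , trans (+-congˡ (sym eq′)) (trans (sym eq) y≈0)

    -- Cayley–Hamilton without determinants: clearing the first column by
    -- cross-multiplication keeps the diagonal monic of a degree d exceeding
    -- that of all other entries.
    annihilator : ∀ m d (v : Fin m → Carrier) (M : Fin m → Fin m → Carrier) →
      (∀ i → Monic d (M i i)) → (∀ i j → ¬ i ≡ j → Low d (M i j)) →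
      (∀ i → sum (λ j → M i j * v j) ≈ 0#) →
      ∃ λ e → ∃ λ p → Monic e p × (∀ i → p * v i ≈ 0#)
    annihilator zero    d v M monic low eqs = 0 , 1# , (0# , Level.lift refl , sym (+-identityʳ 1#)) , λ ()
    annihilator (suc m) d v M monic low eqs =
      let e , p , monic-p , kills = annihilator m (d ℕ.+ d) (v ∘ Fin.suc) M′ monic′ low′ eqs′
      -- `p` kills the tail of `v`. The first row equates `M₀₀ * v₀` with minus a combination of the
      -- tail, so `p * M₀₀` kills `v₀` as well, without any division by `M₀₀`.
      in e ℕ.+ d , p * M₀₀ , Monic-* e d monic-p (monic Fin.zero) ,
         λ { Fin.zero    → kills-first p kills
           ; (Fin.suc i) → trans (solve 3 (λ p M v → p :* M :* v := M :* (p :* v)) refl p M₀₀ (v (Fin.suc i)))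
                             (trans (*-congˡ (kills i)) (zeroʳ _)) }
      where
      M₀₀ = M Fin.zero Fin.zero
      M′ : Fin m → Fin m → Carrier
      M′ i j = M₀₀ * M (Fin.suc i) (Fin.suc j) + - (M (Fin.suc i) Fin.zero * M Fin.zero (Fin.suc j))
      cross : ∀ i j → Low (d ℕ.+ d) (- (M (Fin.suc i) Fin.zero * M Fin.zero (Fin.suc j)))
      cross i j = Low-neg (d ℕ.+ d) (Low-* d d (low (Fin.suc i) Fin.zero λ ()) (low Fin.zero (Fin.suc j) λ ()))
      monic′ : ∀ i → Monic (d ℕ.+ d) (M′ i i)
      monic′ i = Monic-+-Low (d ℕ.+ d) (Monic-* d d (monic Fin.zero) (monic (Fin.suc i))) (cross i i)
      low′ : ∀ i j → ¬ i ≡ j → Low (d ℕ.+ d) (M′ i j)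
      low′ i j i≢j = Low-+ (d ℕ.+ d)
        (Monic*Low d d (monic Fin.zero) (low (Fin.suc i) (Fin.suc j) (i≢j ∘ Fin.suc-injective))) (cross i j)
      eqs′ : ∀ i → sum (λ j → M′ i j * v (Fin.suc j)) ≈ 0#
      eqs′ i = begin
        sum (λ j → M′ i j * v (Fin.suc j))
          ≈⟨ sum-cong-≋ (λ j → solve 5 (λ M₀₀ Mij Mi₀ M₀j v → (M₀₀ :* Mij :+ :- (Mi₀ :* M₀j)) :* v
                 := M₀₀ :* (Mij :* v) :+ :- Mi₀ :* (M₀j :* v)) refl
                 M₀₀ (M (Fin.suc i) (Fin.suc j)) Mi₀ (M Fin.zero (Fin.suc j)) (v (Fin.suc j))) ⟩
        sum (λ j → M₀₀ * (M (Fin.suc i) (Fin.suc j) * v (Fin.suc j)) + - Mi₀ * (M Fin.zero (Fin.suc j) * v (Fin.suc j)))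
          ≈⟨ ∑-distrib-+ {m} _ _ ⟩
        _ ≈⟨ +-cong (*-distribˡ-sum {m} _ _) (*-distribˡ-sum {m} _ _) ⟨
        M₀₀ * rowᵢ + - Mi₀ * row₀
          -- The two terms `M₀₀ * Mi₀ * v₀` inserted here cancel each other; they complete the
          -- truncated rows to the full rows, which vanish.
          ≈⟨ solve 5 (λ M₀₀ Mi₀ v rᵢ r₀ → M₀₀ :* rᵢ :+ :- Mi₀ :* r₀
                 := M₀₀ :* (Mi₀ :* v :+ rᵢ) :+ :- Mi₀ :* (M₀₀ :* v :+ r₀)) refl M₀₀ Mi₀ (v Fin.zero) rowᵢ row₀ ⟩
        M₀₀ * (Mi₀ * v Fin.zero + rowᵢ) + - Mi₀ * (M₀₀ * v Fin.zero + row₀)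
          ≈⟨ +-cong (*-congˡ (eqs (Fin.suc i))) (*-congˡ (eqs Fin.zero)) ⟩
        M₀₀ * 0# + - Mi₀ * 0#
          ≈⟨ solve 2 (λ a b → a :* con (+ 0) :+ b :* con (+ 0) := con (+ 0)) refl M₀₀ (- Mi₀) ⟩
        0# ∎
        where
        Mi₀  = M (Fin.suc i) Fin.zero
        rowᵢ = sum (λ j → M (Fin.suc i) (Fin.suc j) * v (Fin.suc j))
        row₀ = sum (λ j → M Fin.zero (Fin.suc j) * v (Fin.suc j))
      kills-first : ∀ p → (∀ i → p * v (Fin.suc i) ≈ 0#) → p * M₀₀ * v Fin.zero ≈ 0#
      kills-first p kills = begin
        p * M₀₀ * v Fin.zero                  ≈⟨ solve 4 (λ p M v r → p :* M :* v := p :* (M :* v :+ r) :+ :- (p :* r)) refl p M₀₀ (v Fin.zero) rest ⟩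
        p * (M₀₀ * v Fin.zero + rest) - p * rest ≈⟨ +-cong (trans (*-congˡ (eqs Fin.zero)) (zeroʳ p)) (-‿cong p*rest) ⟩
        0# - 0#                               ≈⟨ -‿inverseʳ 0# ⟩
        0# ∎
        where
        rest = sum (λ j → M Fin.zero (Fin.suc j) * v (Fin.suc j))
        p*rest : p * rest ≈ 0#
        p*rest = trans (*-distribˡ-sum {m} p _) (trans
          (sum-cong-≋ (λ j → trans (solve 3 (λ p M v → p :* (M :* v) := M :* (p :* v)) refl p (M Fin.zero (Fin.suc j)) (v (Fin.suc j)))
            (trans (*-congˡ (kills j)) (zeroʳ _)))) (sum-replicate-zero m))

  module _ {m : ℕ} (v : Fin m → Carrier) where

    InSpan : Carrier → Set ℓ
    InSpan z = ∃ λ (a : Fin m → ℤ) → z ≈ sum (λ i → κ (a i) * v i)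

    -- The multiplier ring of the lattice spanned by `v`. It contains ℤ and is closed under sums and
    -- products by linearity alone.
    Stabilises : Carrier → Set ℓ
    Stabilises y = ∀ i → InSpan (y * v i)

    δ : Fin m → Fin m → ℤ
    δ i j with i Fin.≟ j
    ... | yes _ = + 1
    ... | no  _ = + 0

    InSpan-resp : ∀ {y z} → y ≈ z → InSpan y → InSpan z
    InSpan-resp y≈z (a , eq) = a , trans (sym y≈z) eq

    InSpan-0 : InSpan 0#
    InSpan-0 = (λ _ → + 0) , sym (trans (sum-cong-≋ (λ i → zeroˡ (v i))) (sum-replicate-zero m))

    InSpan-+ : ∀ {y z} → InSpan y → InSpan z → InSpan (y + z)
    InSpan-+ (a , eq) (b , eq′) = (λ i → a i ℤ.+ b i) ,
      trans (+-cong eq eq′) (trans (sym (∑-distrib-+ {m} _ _))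
        (sum-cong-≋ (λ i → sym (trans (*-congʳ (κ-+ (a i) (b i))) (distribʳ _ _ _)))))

    InSpan-κ* : ∀ k {y} → InSpan y → InSpan (κ k * y)
    InSpan-κ* k (a , eq) = (λ i → k ℤ.* a i) ,
      trans (*-congˡ eq) (trans (*-distribˡ-sum {m} _ _)
        (sum-cong-≋ (λ i → sym (trans (*-congʳ (κ-* k (a i))) (*-assoc _ _ _)))))

    InSpan-sum : ∀ {n} (f : Fin n → Carrier) → (∀ i → InSpan (f i)) → InSpan (sum f)
    InSpan-sum {zero}  f span = InSpan-0
    InSpan-sum {suc n} f span = InSpan-+ (span Fin.zero) (InSpan-sum (f ∘ Fin.suc) (span ∘ Fin.suc))

    Stabilises-resp : ∀ {y z} → y ≈ z → Stabilises y → Stabilises z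
    Stabilises-resp y≈z st i = InSpan-resp (*-congʳ y≈z) (st i)

    Stabilises-+ : ∀ {y z} → Stabilises y → Stabilises z → Stabilises (y + z)
    Stabilises-+ st st′ i = InSpan-resp (sym (distribʳ _ _ _)) (InSpan-+ (st i) (st′ i))

    Stabilises-span : ∀ {y z} → Stabilises y → InSpan z → InSpan (y * z)
    Stabilises-span {y} st (a , eq) = InSpan-resp
      (sym (trans (*-congˡ eq) (trans (*-distribˡ-sum {m} _ _)
        (sum-cong-≋ (λ i → solve 3 (λ y a v → y :* (a :* v) := a :* (y :* v)) refl y (κ (a i)) (v i))))))
      (InSpan-sum _ (λ i → InSpan-κ* (a i) (st i)))

    Stabilises-* : ∀ {y z} → Stabilises y → Stabilises z → Stabilises (y * z)
    Stabilises-* st st′ i = InSpan-resp (sym (*-assoc _ _ _)) (Stabilises-span st (st′ i))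

    sum-δ : ∀ i → sum (λ j → κ (δ i j) * v j) ≈ v i
    sum-δ i = sift m v i (λ j → κ (δ i j)) (λ j i≢j → off j i≢j) on
      where
      off : ∀ j → ¬ i ≡ j → κ (δ i j) ≈ 0#
      off j i≢j with i Fin.≟ j
      ... | yes i≡j = contradiction i≡j i≢j
      ... | no  _   = refl
      on : κ (δ i i) ≈ 1#
      on with i Fin.≟ i
      ... | yes _   = κ-1
      ... | no  i≢i = contradiction ≡.refl i≢i
      sift : ∀ n (w : Fin n → Carrier) i (e : Fin n → Carrier) → (∀ j → ¬ i ≡ j → e j ≈ 0#) → e i ≈ 1# →
        sum (λ j → e j * w j) ≈ w i
      sift (suc n) w Fin.zero e off on = trans (+-cong (trans (*-congʳ on) (*-identityˡ _))
        (trans (sum-cong-≋ (λ j → trans (*-congʳ (off (Fin.suc j) (λ ()))) (zeroˡ _))) (sum-replicate-zero n)))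
        (+-identityʳ _)
      sift (suc n) w (Fin.suc i) e off on = trans (+-cong (trans (*-congʳ (off Fin.zero (λ ()))) (zeroˡ _))
        (sift n (w ∘ Fin.suc) i (e ∘ Fin.suc) (λ j i≢j → off (Fin.suc j) (i≢j ∘ Fin.suc-injective)) on))
        (+-identityˡ _)

    InSpan-generator : ∀ i → InSpan (v i)
    InSpan-generator i = δ i , sym (sum-δ i)

    Stabilises-κ : ∀ k → Stabilises (κ k)
    Stabilises-κ k i = InSpan-κ* k (InSpan-generator i)

    -- Writing x vᵢ = Σ Aᵢⱼ vⱼ with integers Aᵢⱼ gives (x I - A) v = 0, a system monic of degree 1
    -- on the diagonal and constant off it. Its annihilator kills every generator, and a generator
    -- equal to 1 forces the annihilator itself to be 0.
    stabiliser-integral : ∀ i → v i ≈ 1# → ∀ {x} → Stabilises x → IsAlgebraicInteger K x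
    stabiliser-integral i₀ v≈1 {x} st =
      let e , p , monic-p , kills = annihilator x m 1 v M monic low eqs
      in root⇒integral x e monic-p (trans (sym (*-identityʳ p)) (trans (*-congˡ (sym v≈1)) (kills i₀)))
      where
      A : Fin m → Fin m → ℤ
      A i = proj₁ (st i)
      M : Fin m → Fin m → Carrier
      M i j = κ (δ i j) * x - κ (A i j)
      monic : ∀ i → Monic x 1 (M i i)
      monic i with i Fin.≟ i
      ... | yes _   = - κ (A i i) , Low-neg x 1 (Low-κ x (A i i)) ,
                      +-congʳ (trans (*-comm _ x) (*-congˡ κ-1))
      ... | no  i≢i = contradiction ≡.refl i≢i
      low : ∀ i j → ¬ i ≡ j → Low x 1 (M i j)
      low i j i≢j with i Fin.≟ j
      ... | yes i≡j = contradiction i≡j i≢j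
      ... | no  _   = Low-resp x 1 (sym (trans (+-congʳ (zeroˡ x)) (+-identityˡ _))) (Low-neg x 1 (Low-κ x (A i j)))
      eqs : ∀ i → sum (λ j → M i j * v j) ≈ 0#
      eqs i = begin
        sum (λ j → M i j * v j)
          ≈⟨ sum-cong-≋ (λ j → solve 4 (λ e x a v → (e :* x :- a) :* v := x :* (e :* v) :+ con -[1+ 0 ] :* (a :* v)) refl (κ (δ i j)) x (κ (A i j)) (v j)) ⟩
        sum (λ j → x * (κ (δ i j) * v j) + κ -[1+ 0 ] * (κ (A i j) * v j))
          ≈⟨ ∑-distrib-+ {m} _ _ ⟩
        _ ≈⟨ +-cong (*-distribˡ-sum {m} _ _) (*-distribˡ-sum {m} _ _) ⟨
        x * sum (λ j → κ (δ i j) * v j) + κ -[1+ 0 ] * sum (λ j → κ (A i j) * v j)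
          ≈⟨ +-cong (*-congˡ (sum-δ i)) (*-congˡ (sym (proj₂ (st i)))) ⟩
        x * v i + κ -[1+ 0 ] * (x * v i)
          ≈⟨ solve 1 (λ y → y :+ con -[1+ 0 ] :* y := con (+ 0)) refl (x * v i) ⟩
        0# ∎

-- Sums over initial segments of ℕ and their reindexing.

module RangeSums {c ℓ : Level} (K : Char0Field c ℓ) where
  open Char0Field K
  open CommutativeRing cring
  open IntegerEmbedding cring
  open Solver
  open SetoidReasoning setoid

  sumK-cong : ∀ xs {f g} → (∀ i → f i ≈ g i) → sumK K xs f ≈ sumK K xs g
  sumK-cong []       f≈g = refl
  sumK-cong (x ∷ xs) f≈g = +-cong (f≈g x) (sumK-cong xs f≈g)

  sumK-0 : ∀ xs → sumK K xs (λ _ → 0#) ≈ 0#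
  sumK-0 []       = refl
  sumK-0 (x ∷ xs) = trans (+-identityˡ _) (sumK-0 xs)

  sumK-+ : ∀ xs f g → sumK K xs (λ i → f i + g i) ≈ sumK K xs f + sumK K xs g
  sumK-+ []       f g = sym (+-identityˡ 0#)
  sumK-+ (x ∷ xs) f g = trans (+-congˡ (sumK-+ xs f g))
    (solve 4 (λ a b s t → a :+ b :+ (s :+ t) := a :+ s :+ (b :+ t)) refl (f x) (g x) (sumK K xs f) (sumK K xs g))

  sumK-*ˡ : ∀ xs k f → sumK K xs (λ i → k * f i) ≈ k * sumK K xs f
  sumK-*ˡ []       k f = sym (zeroʳ k)
  sumK-*ˡ (x ∷ xs) k f = trans (+-congˡ (sumK-*ˡ xs k f)) (sym (distribˡ k _ _))

  sumK-*ʳ : ∀ xs k f → sumK K xs (λ i → f i * k) ≈ sumK K xs f * k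
  sumK-*ʳ xs k f = trans (sumK-cong xs (λ i → *-comm (f i) k)) (trans (sumK-*ˡ xs k f) (*-comm k _))

  sumK-comm : ∀ xs ys (f : ℕ → ℕ → Carrier) →
    sumK K xs (λ i → sumK K ys (f i)) ≈ sumK K ys (λ j → sumK K xs (λ i → f i j))
  sumK-comm []       ys f = sym (sumK-0 ys)
  sumK-comm (x ∷ xs) ys f = trans (+-congˡ (sumK-comm xs ys f)) (sym (sumK-+ ys (f x) _))

  ∑ : ℕ → (ℕ → Carrier) → Carrier
  ∑ n f = sumK K (upTo n) f

  -- The tail of `upTo` is no longer an `upTo`; an arbitrary `g` lets the induction go through.
  sumK≡sum : ∀ n (g : ℕ → ℕ) f → sumK K (applyUpTo g n) f ≡ sum {n} (λ i → f (g (toℕ i)))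
  sumK≡sum zero    g f = ≡.refl
  sumK≡sum (suc n) g f = ≡.cong (λ s → f (g 0) + s) (sumK≡sum n (g ∘ suc) f)

  ∑-cong : ∀ n {f g} → (∀ i → i ℕ.< n → f i ≈ g i) → ∑ n f ≈ ∑ n g
  ∑-cong n {f} {g} f≈g = begin
    ∑ n f                       ≡⟨ sumK≡sum n id f ⟩
    sum {n} (λ i → f (toℕ i))   ≈⟨ sum-cong-≋ (λ i → f≈g (toℕ i) (Fin.toℕ<n i)) ⟩
    sum {n} (λ i → g (toℕ i))   ≡⟨ sumK≡sum n id g ⟨
    ∑ n g                       ∎

  ∑-split : ∀ m n f → ∑ (m ℕ.+ n) f ≈ ∑ m f + ∑ n (λ i → f (m ℕ.+ i))
  ∑-split m n f = go m id
    where
    shifted : ∀ n (g h : ℕ → ℕ) f → sumK K (applyUpTo (g ∘ h) n) f ≈ sumK K (applyUpTo h n) (f ∘ g)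
    shifted zero    g h f = refl
    shifted (suc n) g h f = +-congˡ (shifted n g (h ∘ suc) f)
    go : ∀ m (g : ℕ → ℕ) → sumK K (applyUpTo g (m ℕ.+ n)) f
       ≈ sumK K (applyUpTo g m) f + ∑ n (λ i → f (g (m ℕ.+ i)))
    go zero    g = trans (shifted n g id f) (sym (+-identityˡ _))
    go (suc m) g = trans (+-congˡ (go m (g ∘ suc))) (sym (+-assoc _ _ _))

  ∑-affine : ∀ c .{{_ : ℕ.NonZero c}} a d k → a ℤ.* d ≅ + 1 [ c ] → ∀ f →
    ∑ c (λ j → f ((a ℤ.* + j ℤ.+ k) %ℕ c)) ≈ ∑ c f
  ∑-affine c a d k ad≅1 f = sym (begin
    ∑ c f                                          ≡⟨ sumK≡sum c id f ⟩
    sum {c} (λ i → f (toℕ i))                      ≈⟨ sum-permute (λ i → f (toℕ i)) (affine c a d k ad≅1) ⟩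
    sum {c} (λ i → f (toℕ (affine c a d k ad≅1 ⟨$⟩ʳ i)))
      ≈⟨ sum-cong-≋ {c} (λ i → reflexive (≡.cong f (Fin.toℕ-fromℕ< (n%ℕd<d (a ℤ.* + toℕ i ℤ.+ k) c)))) ⟩
    sum {c} (λ i → f ((a ℤ.* + toℕ i ℤ.+ k) %ℕ c)) ≡⟨ sumK≡sum c id (λ j → f ((a ℤ.* + j ℤ.+ k) %ℕ c)) ⟨
    ∑ c (λ j → f ((a ℤ.* + j ℤ.+ k) %ℕ c))         ∎)

-- Scaled Bernoulli values, character sums and moments.

module Characters {c ℓ : Level} (K : Char0Field c ℓ) where
  open Char0Field K
  open CommutativeRing cring
  open IntegerEmbedding cring
  open RangeSums K
  open Solver
  open SetoidReasoning setoid
  open Algebra.Properties.Ring ring using (-‿distribˡ-*)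

  inverse-unique : ∀ {u v x y} → u ≈ v → u * x ≈ 1# → v * y ≈ 1# → x ≈ y
  inverse-unique {u} {v} {x} {y} u≈v ux≈1 vy≈1 = begin
    x           ≈⟨ *-identityʳ x ⟨
    x * 1#      ≈⟨ *-congˡ vy≈1 ⟨
    x * (v * y) ≈⟨ *-congˡ (*-congʳ u≈v) ⟨
    x * (u * y) ≈⟨ solve 3 (λ x u y → x :* (u :* y) := u :* x :* y) refl x u y ⟩
    u * x * y   ≈⟨ *-congʳ ux≈1 ⟩
    1# * y      ≈⟨ *-identityˡ y ⟩
    y           ∎

  cancel : ∀ {u x y} → ¬ (u ≈ 0#) → u * x ≈ u * y → x ≈ y
  cancel {u} {x} {y} u≉0 eq = begin
    x              ≈⟨ *-identityˡ x ⟨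
    1# * x         ≈⟨ *-congʳ (⁻¹-inverse u u≉0) ⟨
    u * u ⁻¹ * x   ≈⟨ solve 3 (λ u i x → u :* i :* x := i :* (u :* x)) refl u (u ⁻¹) x ⟩
    u ⁻¹ * (u * x) ≈⟨ *-congˡ eq ⟩
    u ⁻¹ * (u * y) ≈⟨ solve 3 (λ u i x → u :* i :* x := i :* (u :* x)) refl u (u ⁻¹) y ⟨
    u * u ⁻¹ * y   ≈⟨ *-congʳ (⁻¹-inverse u u≉0) ⟩
    1# * y         ≈⟨ *-identityˡ y ⟩
    y              ∎

  -- (u - 1) x = 0 with u - 1 nonzero: the orthogonality trick that makes the sum of a nontrivial
  -- character over a period vanish.
  cancel-fixed : ∀ {u x} → ¬ (u ≈ 1#) → u * x ≈ x → x ≈ 0#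
  cancel-fixed {u} {x} u≉1 ux≈x = cancel (λ u-1≈0 → u≉1 (begin
      u             ≈⟨ solve 2 (λ u o → u := u :- o :+ o) refl u 1# ⟩
      u - 1# + 1#   ≈⟨ +-congʳ u-1≈0 ⟩
      0# + 1#       ≈⟨ +-identityˡ 1# ⟩
      1#            ∎)) (begin
    (u - 1#) * x    ≈⟨ distribʳ x u (- 1#) ⟩
    u * x + - 1# * x ≈⟨ +-cong ux≈x (sym (-‿distribˡ-* 1# x)) ⟩
    x - 1# * x      ≈⟨ +-congˡ (-‿cong (*-identityˡ x)) ⟩
    x - x           ≈⟨ -‿inverseʳ x ⟩
    0#              ≈⟨ zeroʳ _ ⟨
    (u - 1#) * 0#   ∎)

  κ-pos≉0 : ∀ n .{{_ : ℕ.NonZero n}} → ¬ (κ (+ n) ≈ 0#)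
  κ-pos≉0 (suc n) = char0 n

  -- For a nonzero residue s the right side is s - (k - s); for residue 0 it is 0 - 0, because
  -- negation fixes 0. The difference of the two residues thus covers both branches of `B1` in one
  -- formula.
  B1-scaled : ∀ k .{{_ : ℕ.NonZero k}} y →
    κ (+ (2 ℕ.* k)) * B1 K y k ≈ κ (+ (y %ℕ k) ℤ.- + ((ℤ.- y) %ℕ k))
  B1-scaled k@(suc k′) y with y %ℕ k in eq
  ... | zero  = trans (zeroʳ _) (reflexive (≡.cong (λ s → κ (+ 0 ℤ.- + s)) (≡.sym (neg-%ℕ-zero k y eq))))
  ... | suc s = begin
    κ (+ (2 ℕ.* k)) * (κ (+ (2 ℕ.* suc s) ℤ.- + k) * κ (+ (2 ℕ.* k)) ⁻¹)
      ≈⟨ solve 3 (λ u v i → u :* (v :* i) := u :* i :* v) refl (κ (+ (2 ℕ.* k))) (κ (+ (2 ℕ.* suc s) ℤ.- + k)) (κ (+ (2 ℕ.* k)) ⁻¹) ⟩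
    κ (+ (2 ℕ.* k)) * κ (+ (2 ℕ.* k)) ⁻¹ * κ (+ (2 ℕ.* suc s) ℤ.- + k)
      ≈⟨ trans (*-congʳ (⁻¹-inverse _ (κ-pos≉0 (2 ℕ.* k)))) (*-identityˡ _) ⟩
    κ (+ (2 ℕ.* suc s) ℤ.- + k)
      ≡⟨ ≡.cong κ (≡.trans (≡.cong (λ z → z ℤ.- + k) (ℤ.pos-* 2 (suc s))) (lemma (+ suc s) (+ k))) ⟩
    κ (+ suc s ℤ.- (+ k ℤ.- + suc s))
      ≡⟨ ≡.cong (λ z → κ (+ suc s ℤ.- z)) (neg-%ℕ-suc k y eq) ⟨
    κ (+ suc s ℤ.- + ((ℤ.- y) %ℕ k)) ∎
    where
    lemma : ∀ s k → + 2 ℤ.* s ℤ.- k ≡ s ℤ.- (k ℤ.- s)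
    lemma = solve-∀

  record Character (q : ℕ) (ψ : ℤ → Carrier) : Set (c ⊔ ℓ) where
    field
      periodic   : ∀ {x y} → x ≅ y [ q ] → ψ x ≈ ψ y
      mult       : ∀ x y → ψ (x ℤ.* y) ≈ ψ x * ψ y
      one        : ψ (+ 1) ≈ 1#
      -- The inverse `v` is part of the data so that multiplication by `u` can serve as an affine
      -- permutation of the residues.
      nontrivial : ∃ λ u → ∃ λ v → u ℤ.* v ≅ + 1 [ q ] × ¬ (ψ u ≈ 1#)

    -- ψ(u) ψ(0) = ψ(u · 0) = ψ(0) with ψ(u) different from 1. This removes the index j = 0, whose
    -- reflection is 0 instead of m.
    at-zero : ψ (+ 0) ≈ 0#
    at-zero = let u , _ , _ , ψu≉1 = nontrivial in
      cancel-fixed ψu≉1 (trans (sym (mult u (+ 0))) (reflexive (≡.cong ψ (ℤ.*-zeroʳ u))))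

    -- Substituting j ↦ a j + k multiplies a character sum by the inverse of ψ(a).
    twist : ∀ m .{{_ : ℕ.NonZero m}} p → m ≡ p ℕ.* q → ∀ a d k → a ℤ.* d ≅ + 1 [ m ] → k ≅ + 0 [ q ] →
      ∀ (f : ℕ → Carrier) →
      ∑ m (λ j → ψ (+ j) * f ((a ℤ.* + j ℤ.+ k) %ℕ m)) ≈ ψ d * ∑ m (λ j → ψ (+ j) * f j)
    twist m p m≡pq a d k ad≅1 k≅0 f = begin
      ∑ m (λ j → ψ (+ j) * f (r j))             ≈⟨ sumK-cong (upTo m) (λ j → *-congʳ (unfold j)) ⟩
      ∑ m (λ j → ψ d * ψ (+ r j) * f (r j))     ≈⟨ sumK-cong (upTo m) (λ j → *-assoc _ _ _) ⟩
      ∑ m (λ j → ψ d * (ψ (+ r j) * f (r j)))   ≈⟨ sumK-*ˡ (upTo m) (ψ d) _ ⟩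
      ψ d * ∑ m (λ j → ψ (+ r j) * f (r j))     ≈⟨ *-congˡ (∑-affine m a d k ad≅1 (λ j → ψ (+ j) * f j)) ⟩
      ψ d * ∑ m (λ j → ψ (+ j) * f j)           ∎
      where
      r : ℕ → ℕ
      r j = (a ℤ.* + j ℤ.+ k) %ℕ m
      coarsen : ∀ {x y} → x ≅ y [ m ] → x ≅ y [ q ]
      coarsen {x} {y} h = ≅-coarsen p q (≡.subst (λ n → x ≅ y [ n ]) m≡pq h)
      lemma : ∀ a d j → d ℤ.* (a ℤ.* j ℤ.+ + 0) ≡ j ℤ.* (a ℤ.* d)
      lemma = solve-∀
      -- d (a j + k) ≡ j mod q, since k ≡ 0 and a d ≡ 1; reducing mod m first changes nothing
      -- because q divides m.
      unfold : ∀ j → ψ (+ j) ≈ ψ d * ψ (+ r j)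
      unfold j = sym (trans (sym (mult d (+ r j))) (periodic
        (≅-trans (≅-*ˡ d (≅-trans (coarsen (%ℕ-≅ m (a ℤ.* + j ℤ.+ k))) (≅-+ (≅-refl {a ℤ.* + j}) k≅0)))
          (≅-trans (≅-reflexive (lemma a d (+ j)))
            (≅-trans (≅-*ˡ (+ j) (coarsen ad≅1)) (≅-reflexive (ℤ.*-identityʳ (+ j))))))))

    reflect : ∀ k .{{_ : ℕ.NonZero k}} p → k ≡ p ℕ.* q → ∀ (f : ℕ → Carrier) →
      ∑ k (λ j → ψ (+ j) * f (neg k j)) ≈ ψ -[1+ 0 ] * ∑ k (λ j → ψ (+ j) * f j)
    reflect k p k≡pq f = trans
      (sumK-cong (upTo k) λ j → *-congˡ (reflexive (≡.cong (λ y → f (y %ℕ k)) (lemma (+ j)))))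
      (twist k p k≡pq -[1+ 0 ] -[1+ 0 ] (+ 0) ≅-refl ≅-refl f)
      where
      lemma : ∀ j → ℤ.- j ≡ -[1+ 0 ] ℤ.* j ℤ.+ + 0
      lemma = solve-∀

    -- The weights `f` are integers, which keeps every moment in the ℤ-span of the values of ψ.
    moment : ℕ → (ℕ → ℤ) → Carrier
    moment m f = ∑ m (λ j → ψ (+ j) * κ (f j))

    moment-block : ∀ t f → moment (suc t ℕ.* q) f ≈ moment q f + moment (t ℕ.* q) (λ j → f (q ℕ.+ j))
    moment-block t f = trans (∑-split q (t ℕ.* q) _) (+-congˡ (sumK-cong (upTo (t ℕ.* q)) λ j →
      *-congʳ (periodic (+ 1 , lemma q j))))
      where
      lemma : ∀ q j → + (q ℕ.+ j) ≡ + j ℤ.+ + 1 ℤ.* + q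
      lemma q j = ≡.trans (ℤ.pos-+ q j) (≡.trans (ℤ.+-comm (+ q) (+ j)) (≡.cong (λ z → + j ℤ.+ z) (≡.sym (ℤ.*-identityˡ (+ q)))))

    moment-+ : ∀ m f g → moment m (λ j → f j ℤ.+ g j) ≈ moment m f + moment m g
    moment-+ m f g = trans (sumK-cong (upTo m) λ j → trans (*-congˡ (κ-+ (f j) (g j))) (distribˡ _ _ _)) (sumK-+ (upTo m) _ _)

    moment-*ˡ : ∀ m k f → moment m (λ j → k ℤ.* f j) ≈ κ k * moment m f
    moment-*ˡ m k f = trans (sumK-cong (upTo m) λ j → trans (*-congˡ (κ-* k (f j)))
      (solve 3 (λ w k z → w :* (k :* z) := k :* (w :* z)) refl (ψ (+ j)) (κ k) (κ (f j)))) (sumK-*ˡ (upTo m) _ _)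

    module _ .{{_ : ℕ.NonZero q}} where

      private
        full-period : ∑ q (λ j → ψ (+ j)) ≈ 0#
        full-period = let u , v , uv≅1 , ψu≉1 = nontrivial in cancel-fixed ψu≉1 (begin
          ψ u * ∑ q (λ j → ψ (+ j))                           ≈⟨ sumK-*ˡ (upTo q) _ _ ⟨
          ∑ q (λ j → ψ u * ψ (+ j))                           ≈⟨ sumK-cong (upTo q) (λ j → trans (sym (mult u (+ j))) (periodic
                                                                   (≅-trans (≅-reflexive (≡.sym (ℤ.+-identityʳ _))) (≅-sym (%ℕ-≅ q _))))) ⟩
          ∑ q (λ j → ψ (+ ((u ℤ.* + j ℤ.+ + 0) %ℕ q)))        ≈⟨ ∑-affine q u v (+ 0) uv≅1 (λ j → ψ (+ j)) ⟩
          ∑ q (λ j → ψ (+ j))                                 ∎)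

      moment-const-period : ∀ k → moment q (λ _ → k) ≈ 0#
      moment-const-period k = trans (sumK-*ʳ (upTo q) (κ k) _) (trans (*-congʳ full-period) (zeroˡ _))

      moment-const : ∀ t k → moment (t ℕ.* q) (λ _ → k) ≈ 0#
      moment-const zero    k = refl
      moment-const (suc t) k = trans (moment-block t (λ _ → k)) (trans (+-cong (moment-const-period k) (moment-const t k)) (+-identityʳ 0#))

      -- Shifting j by a period adds the constant q, whose moment vanishes, so all t periods
      -- contribute equally.
      first-moment : ∀ t → moment (t ℕ.* q) (+_) ≈ κ (+ t) * moment q (+_)
      first-moment zero    = sym (zeroˡ _)
      first-moment (suc t) = begin
        moment (suc t ℕ.* q) (+_)                                       ≈⟨ moment-block t (+_) ⟩
        moment q (+_) + moment (t ℕ.* q) (λ j → + q ℤ.+ + j)            ≈⟨ +-congˡ (moment-+ (t ℕ.* q) (λ _ → + q) (+_)) ⟩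
        moment q (+_) + (moment (t ℕ.* q) (λ _ → + q) + moment (t ℕ.* q) (+_))
          ≈⟨ +-congˡ (trans (+-congʳ (moment-const t (+ q))) (+-identityˡ _)) ⟩
        moment q (+_) + moment (t ℕ.* q) (+_)                             ≈⟨ +-cong (sym (*-identityˡ _)) (first-moment t) ⟩
        1# * moment q (+_) + κ (+ t) * moment q (+_)                      ≈⟨ distribʳ _ _ _ ⟨
        κ (+ suc t) * moment q (+_)                                     ∎

  -- The conjugate of a Dirichlet character is again a character.

  module Conjugate {q : ℕ} {χ : ℤ → Carrier} (isChar : IsDirichletChar K q χ) where
    open IsDirichletChar isChar

    ψ : ℤ → Carrier
    ψ = conjChar K q χ

    conj-unit : ∀ n → Coprime K n q → χ n * ψ n ≈ 1#
    conj-unit n n⊥q with gcd ∣ n ∣ q ℕ.≟ 1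
    ... | yes _ = ⁻¹-inverse (χ n) (unit n n⊥q)
    ... | no ¬p = contradiction n⊥q ¬p

    conj-nonunit : ∀ n → ¬ Coprime K n q → ψ n ≈ 0#
    conj-nonunit n ¬n⊥q with gcd ∣ n ∣ q ℕ.≟ 1
    ... | yes p = contradiction p ¬n⊥q
    ... | no _  = refl

    coprime : ∀ n → ¬ (χ n ≈ 0#) → Coprime K n q
    coprime n χn≉0 with gcd ∣ n ∣ q ℕ.≟ 1
    ... | yes p = p
    ... | no ¬p = contradiction (nonunit n ¬p) χn≉0

    -- `conjChar` branches on a gcd, but the vanishing of χ detects the branch, so its value is
    -- determined by that of χ.
    conj-cong : ∀ x y → χ x ≈ χ y → ψ x ≈ ψ y
    conj-cong x y χx≈χy with gcd ∣ x ∣ q ℕ.≟ 1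
    ... | yes x⊥q = inverse-unique χx≈χy (⁻¹-inverse (χ x) (unit x x⊥q))
                      (conj-unit y (coprime y (λ χy≈0 → unit x x⊥q (trans χx≈χy χy≈0))))
    ... | no ¬x⊥q = sym (conj-nonunit y (λ y⊥q → unit y y⊥q (trans (sym χx≈χy) (nonunit x ¬x⊥q))))

    χ-periodic : ∀ {x y} → x ≅ y [ q ] → χ x ≈ χ y
    χ-periodic {y = y} (k , ≡.refl) = go y k
      where
      up : ∀ x m → χ (x ℤ.+ + m ℤ.* + q) ≈ χ x
      up x zero    = reflexive (≡.cong χ (lemma x (+ q)))
        where
        lemma : ∀ x q → x ℤ.+ + 0 ℤ.* q ≡ x
        lemma = solve-∀
      up x (suc m) = trans (reflexive (≡.cong χ (lemma x (+ m) (+ q)))) (trans (periodic _) (up x m))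
        where
        lemma : ∀ x m q → x ℤ.+ (+ 1 ℤ.+ m) ℤ.* q ≡ x ℤ.+ m ℤ.* q ℤ.+ q
        lemma = solve-∀
      go : ∀ x k → χ (x ℤ.+ k ℤ.* + q) ≈ χ x
      go x (+ m)      = up x m
      go x -[1+ m ]   = trans (sym (up _ (suc m))) (reflexive (≡.cong χ (lemma x (+ suc m) (+ q))))
        where
        lemma : ∀ x m q → x ℤ.+ ℤ.- m ℤ.* q ℤ.+ m ℤ.* q ≡ x
        lemma = solve-∀

    units-* : ∀ {u v x y} → u * x ≈ 1# → v * y ≈ 1# → (u * v) * (x * y) ≈ 1#
    units-* {u} {v} {x} {y} ux≈1 vy≈1 = trans
      (solve 4 (λ u v x y → (u :* v) :* (x :* y) := (u :* x) :* (v :* y)) refl u v x y)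
      (trans (*-cong ux≈1 vy≈1) (*-identityˡ 1#))

    unit≉0 : ∀ {u x} → u * x ≈ 1# → ¬ (u ≈ 0#)
    unit≉0 ux≈1 u≈0 = 1≉0 (trans (sym ux≈1) (trans (*-congʳ u≈0) (zeroˡ _)))

    conj-mult : ∀ m n → ψ (m ℤ.* n) ≈ ψ m * ψ n
    conj-mult m n = by-cases (gcd ∣ m ∣ q ℕ.≟ 1) (gcd ∣ n ∣ q ℕ.≟ 1)
      where
      by-cases : Dec (Coprime K m q) → Dec (Coprime K n q) → ψ (m ℤ.* n) ≈ ψ m * ψ n
      by-cases (yes m⊥q) (yes n⊥q) =
        let both = units-* (conj-unit m m⊥q) (conj-unit n n⊥q)
        in inverse-unique (mult m n)
             (conj-unit (m ℤ.* n) (coprime _ (λ eq → unit≉0 both (trans (sym (mult m n)) eq)))) both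
      by-cases (no ¬m⊥q) _ = trans
        (conj-nonunit (m ℤ.* n) (λ mn⊥q → unit _ mn⊥q (trans (mult m n) (trans (*-congʳ (nonunit m ¬m⊥q)) (zeroˡ _)))))
        (sym (trans (*-congʳ (conj-nonunit m ¬m⊥q)) (zeroˡ _)))
      by-cases _ (no ¬n⊥q) = trans
        (conj-nonunit (m ℤ.* n) (λ mn⊥q → unit _ mn⊥q (trans (mult m n) (trans (*-congˡ (nonunit n ¬n⊥q)) (zeroʳ _)))))
        (sym (trans (*-congˡ (conj-nonunit n ¬n⊥q)) (zeroʳ _)))

    mod-inverse : ∀ n → Coprime K n q → ∃ λ v → n ℤ.* v ≅ + 1 [ q ]
    mod-inverse n n⊥q = signed n n⊥q
      where
      natural : ∀ m → gcd m q ≡ 1 → ∃ λ v → + m ℤ.* v ≅ + 1 [ q ]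
      natural m m⊥q with Bézout.identity (≡.subst (ℕ.GCD m q) m⊥q (gcd-GCD m q))
      ... | Bézout.+- x y eq = + x , (+ y , ≡.trans (ℤ.*-comm (+ m) (+ x)) (cast (x ℕ.* m) eq (ℤ.pos-* x m)))
        where
        cast : ∀ k → 1 ℕ.+ y ℕ.* q ≡ k → + k ≡ + x ℤ.* + m → + x ℤ.* + m ≡ + 1 ℤ.+ + y ℤ.* + q
        cast k eq eq′ = ≡.trans (≡.sym eq′) (≡.trans (≡.cong +_ (≡.sym eq))
          (≡.trans (ℤ.pos-+ 1 (y ℕ.* q)) (≡.cong (λ z → + 1 ℤ.+ z) (ℤ.pos-* y q))))
      ... | Bézout.-+ x y eq = ℤ.- + x , (ℤ.- + y , solved (+ m) (+ x) (+ y) (+ q) cast)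
        where
        cast : + 1 ℤ.+ + x ℤ.* + m ≡ + y ℤ.* + q
        cast = ≡.trans (≡.cong (λ z → + 1 ℤ.+ z) (≡.sym (ℤ.pos-* x m)))
          (≡.trans (≡.sym (ℤ.pos-+ 1 (x ℕ.* m))) (≡.trans (≡.cong +_ eq) (ℤ.pos-* y q)))
        lemma : ∀ m x → m ℤ.* ℤ.- x ≡ + 1 ℤ.- (+ 1 ℤ.+ x ℤ.* m)
        lemma = solve-∀
        lemma′ : ∀ y q → + 1 ℤ.- y ℤ.* q ≡ + 1 ℤ.+ ℤ.- y ℤ.* q
        lemma′ = solve-∀
        solved : ∀ m x y q → + 1 ℤ.+ x ℤ.* m ≡ y ℤ.* q → m ℤ.* ℤ.- x ≡ + 1 ℤ.+ ℤ.- y ℤ.* q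
        solved m x y q eq = ≡.trans (lemma m x) (≡.trans (≡.cong (λ z → + 1 ℤ.- z) eq) (lemma′ y q))
      signed : ∀ n → gcd ∣ n ∣ q ≡ 1 → ∃ λ v → n ℤ.* v ≅ + 1 [ q ]
      signed (+ m)    m⊥q = natural m m⊥q
      signed -[1+ m ] m⊥q = let v , mv≅1 = natural (suc m) m⊥q in ℤ.- v , ≅-trans (≅-reflexive (lemma (+ suc m) v)) mv≅1
        where
        lemma : ∀ m v → ℤ.- m ℤ.* ℤ.- v ≡ m ℤ.* v
        lemma = solve-∀

    conj-one : ψ (+ 1) ≈ 1#
    conj-one = sym (inverse-unique refl (trans (*-identityʳ _) one) (conj-unit (+ 1) (coprime (+ 1) λ eq → 1≉0 (trans (sym one) eq))))

    isCharacter : IsNontrivial K q χ → Character q ψ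
    isCharacter (u , u⊥q , χu≉1) = record
      { periodic   = λ {x} {y} x≅y → conj-cong x y (χ-periodic x≅y)
      ; mult       = conj-mult
      ; one        = conj-one
      ; nontrivial = let v , uv≅1 = mod-inverse u u⊥q in
          u , v , uv≅1 , λ ψu≈1 → χu≉1 (trans (sym (*-identityʳ _)) (trans (*-congˡ (sym ψu≈1)) (conj-unit u u⊥q)))
      }

    conj-minus-one : χ -[1+ 0 ] * ψ -[1+ 0 ] ≈ 1#
    conj-minus-one = conj-unit -[1+ 0 ] (coprime _ λ eq → 1≉0 (trans (sym one)
      (trans (mult -[1+ 0 ] -[1+ 0 ]) (trans (*-congʳ eq) (zeroˡ _)))))

-- The lattice spanned by products of character values.

module CharacterRing {c ℓ : Level} (K : Char0Field c ℓ)
  {q₁ q₂ : ℕ} .{{q₁≢0 : ℕ.NonZero q₁}} .{{q₂≢0 : ℕ.NonZero q₂}}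
  {ψ₁ ψ₂ : ℤ → CommutativeRing.Carrier (Char0Field.cring K)}
  (char₁ : Characters.Character K q₁ ψ₁) (char₂ : Characters.Character K q₂ ψ₂)
  where

  open Char0Field K
  open CommutativeRing cring
  open IntegerEmbedding cring
  open RangeSums K
  open Characters K
  open Integrality K

  private
    module ψ₁ = Character char₁
    module ψ₂ = Character char₂

  generator : ∀ (i : Fin q₁) (j : Fin q₂) → Carrier
  generator i j = ψ₁ (+ toℕ i) * ψ₂ (+ toℕ j)

  -- All pairs of residues are listed, so that ψ₁(z) ψ₁(i) = ψ₁(z i) is again a listed value after
  -- reduction, and likewise for ψ₂. The pair (1, 1) supplies the generator 1 required for
  -- integrality.
  generators : Fin (q₁ ℕ.* q₂) → Carrier
  generators i = generator (Fin.quotient q₂ i) (remainder {q₁} q₂ i)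

  Stable : Carrier → Set ℓ
  Stable = Stabilises generators

  residue : ∀ q .{{_ : ℕ.NonZero q}} → ℤ → Fin q
  residue q z = fromℕ< (n%ℕd<d z q)

  ψ-residue : ∀ {q ψ} (char : Character q ψ) .{{_ : ℕ.NonZero q}} z → ψ (+ toℕ (residue q z)) ≈ ψ z
  ψ-residue {q} {ψ} char z = trans (reflexive (≡.cong (λ k → ψ (+ k)) (Fin.toℕ-fromℕ< (n%ℕd<d z q))))
    (Character.periodic char (%ℕ-≅ q z))

  generators-residue : ∀ y z → generators (combine (residue q₁ y) (residue q₂ z)) ≈ ψ₁ y * ψ₂ z
  generators-residue y z = trans
    (reflexive (≡.cong (λ p → generator (proj₁ p) (proj₂ p)) (Fin.remQuot-combine (residue q₁ y) (residue q₂ z))))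
    (*-cong (ψ-residue char₁ y) (ψ-residue char₂ z))

  product-in-span : ∀ y z → InSpan generators (ψ₁ y * ψ₂ z)
  product-in-span y z = InSpan-resp generators (generators-residue y z)
    (InSpan-generator generators (combine (residue q₁ y) (residue q₂ z)))

  ψ₁-stable : ∀ z → Stable (ψ₁ z)
  ψ₁-stable z i = InSpan-resp generators (trans (*-congʳ (ψ₁.mult z _)) (*-assoc _ _ _))
    (product-in-span (z ℤ.* + toℕ (Fin.quotient q₂ i)) (+ toℕ (remainder {q₁} q₂ i)))

  ψ₂-stable : ∀ z → Stable (ψ₂ z)
  ψ₂-stable z i = InSpan-resp generators (trans (*-congˡ (ψ₂.mult z _)) rearrange)
    (product-in-span (+ toℕ (Fin.quotient q₂ i)) (z ℤ.* + toℕ (remainder {q₁} q₂ i)))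
    where
    open Solver
    rearrange : ∀ {u v w} → u * (v * w) ≈ v * (u * w)
    rearrange {u} {v} {w} = solve 3 (λ u v w → u :* (v :* w) := v :* (u :* w)) refl u v w

  sumK-stable : ∀ xs {f} → (∀ i → Stable (f i)) → Stable (sumK K xs f)
  sumK-stable []       st = Stabilises-κ generators (+ 0)
  sumK-stable (x ∷ xs) st = Stabilises-+ generators (st x) (sumK-stable xs st)

  moment-stable : ∀ {q ψ} (char : Character q ψ) → (∀ z → Stable (ψ z)) → ∀ k f → Stable (Character.moment char k f)
  moment-stable char st k f = sumK-stable (upTo k) λ j → Stabilises-* generators (st (+ j)) (Stabilises-κ generators (f j))

  stable⇒integral : ∀ {y} → Stable y → IsAlgebraicInteger K y
  stable⇒integral = stabiliser-integral generators (combine (residue q₁ (+ 1)) (residue q₂ (+ 1)))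
    (trans (generators-residue (+ 1) (+ 1)) (trans (*-cong ψ₁.one ψ₂.one) (*-identityˡ 1#)))

-- The Dedekind sum of modulus m = q₁ q₂ t and its two integral multiples.

module DedekindSum {c ℓ : Level} (K : Char0Field c ℓ)
  {q₁ q₂ : ℕ} .{{q₁≢0 : ℕ.NonZero q₁}} .{{q₂≢0 : ℕ.NonZero q₂}}
  {ψ₁ ψ₂ : ℤ → CommutativeRing.Carrier (Char0Field.cring K)}
  (char₁ : Characters.Character K q₁ ψ₁) (char₂ : Characters.Character K q₂ ψ₂)
  (t : ℕ) .{{m≢0 : ℕ.NonZero (q₁ ℕ.* (q₂ ℕ.* t))}}
  (a d : ℤ) (ad≅1 : a ℤ.* d ≅ + 1 [ q₁ ℕ.* (q₂ ℕ.* t) ])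
  where

  open Char0Field K
  open CommutativeRing cring
  open IntegerEmbedding cring
  open RangeSums K
  open Characters K
  open Solver
  open SetoidReasoning setoid

  private
    module ψ₁ = Character char₁
    module ψ₂ = Character char₂

  -- Bracketed so that m / q₁ is `m₁` by definition. As q₂ divides `m₁`, a shift by `m₁` n is
  -- invisible to ψ₂.
  m₁ m : ℕ
  m₁ = q₂ ℕ.* t
  m  = q₁ ℕ.* m₁

  m≡q₁m₁ : + m ≡ + q₁ ℤ.* + m₁
  m≡q₁m₁ = ℤ.pos-* q₁ m₁

  m≡[q₁t]q₂ : m ≡ q₁ ℕ.* t ℕ.* q₂
  m≡[q₁t]q₂ = ≡.trans (≡.cong (q₁ ℕ.*_) (ℕ.*-comm q₂ t)) (≡.sym (ℕ.*-assoc q₁ t q₂))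

  -- x / m = a j / m + n / q₁ is the argument of the second B₁; `fl` is its floor, and `r` is m
  -- times its fractional part.
  x r fl : ℕ → ℕ → ℤ
  x j n  = a ℤ.* + j ℤ.+ + m₁ ℤ.* + n
  r j n  = + (x j n %ℕ m)
  fl j n = x j n /ℕ m

  x-division : ∀ j n → x j n ≡ r j n ℤ.+ fl j n ℤ.* + m
  x-division j n = a≡a%ℕn+[a/ℕn]*n (x j n) m

  ⟪_⟫ : (ℕ → ℕ → ℤ) → Carrier
  ⟪ z ⟫ = ∑ m (λ j → ψ₂ (+ j) * ψ₁.moment q₁ (z j))

  ⟪⟫-cong : ∀ {y z} → (∀ j n → y j n ≡ z j n) → ⟪ y ⟫ ≈ ⟪ z ⟫
  ⟪⟫-cong y≡z = sumK-cong (upTo m) λ j → *-congˡ (sumK-cong (upTo q₁) λ n → *-congˡ (reflexive (≡.cong κ (y≡z j n))))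

  ⟪⟫-+ : ∀ y z → ⟪ (λ j n → y j n ℤ.+ z j n) ⟫ ≈ ⟪ y ⟫ + ⟪ z ⟫
  ⟪⟫-+ y z = trans (sumK-cong (upTo m) λ j → trans (*-congˡ (ψ₁.moment-+ q₁ (y j) (z j))) (distribˡ _ _ _))
    (sumK-+ (upTo m) _ _)

  ⟪⟫-*ˡ : ∀ k z → ⟪ (λ j n → k ℤ.* z j n) ⟫ ≈ κ k * ⟪ z ⟫
  ⟪⟫-*ˡ k z = trans (sumK-cong (upTo m) λ j → trans (*-congˡ (ψ₁.moment-*ˡ q₁ k (z j)))
      (solve 3 (λ w k s → w :* (k :* s) := k :* (w :* s)) refl (ψ₂ (+ j)) (κ k) (ψ₁.moment q₁ (z j))))
    (sumK-*ˡ (upTo m) _ _)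

  ⟪⟫-product : ∀ f g → ⟪ (λ j n → f j ℤ.* g n) ⟫ ≈ ψ₂.moment m f * ψ₁.moment q₁ g
  ⟪⟫-product f g = trans (sumK-cong (upTo m) λ j → trans (*-congˡ (ψ₁.moment-*ˡ q₁ (f j) g)) (sym (*-assoc _ _ _)))
    (sumK-*ʳ (upTo m) _ _)

  -- The constant produced by the twist is ψ₂(d) for every n, because the shift m₁ n vanishes mod
  -- q₂; hence the double sum factors even with a weight in n.
  ⟪⟫-residue : ∀ (h : ℕ → ℤ) g →
    ⟪ (λ j n → h (x j n %ℕ m) ℤ.* g n) ⟫ ≈ ψ₂ d * ψ₂.moment m h * ψ₁.moment q₁ g
  ⟪⟫-residue h g = begin
    ∑ m (λ j → ψ₂ (+ j) * ∑ q₁ (λ n → ψ₁ (+ n) * κ (h (x j n %ℕ m) ℤ.* g n)))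
      ≈⟨ sumK-cong (upTo m) (λ j → sym (sumK-*ˡ (upTo q₁) _ _)) ⟩
    ∑ m (λ j → ∑ q₁ (λ n → ψ₂ (+ j) * (ψ₁ (+ n) * κ (h (x j n %ℕ m) ℤ.* g n))))
      ≈⟨ sumK-comm (upTo m) (upTo q₁) _ ⟩
    ∑ q₁ (λ n → ∑ m (λ j → ψ₂ (+ j) * (ψ₁ (+ n) * κ (h (x j n %ℕ m) ℤ.* g n))))
      ≈⟨ sumK-cong (upTo q₁) (λ n → sumK-cong (upTo m) λ j → trans (*-congˡ (*-congˡ (κ-* (h (x j n %ℕ m)) (g n))))
           (solve 4 (λ w₂ w₁ h g → w₂ :* (w₁ :* (h :* g)) := w₂ :* h :* (w₁ :* g)) refl
             (ψ₂ (+ j)) (ψ₁ (+ n)) (κ (h (x j n %ℕ m))) (κ (g n)))) ⟩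
    ∑ q₁ (λ n → ∑ m (λ j → ψ₂ (+ j) * κ (h (x j n %ℕ m)) * (ψ₁ (+ n) * κ (g n))))
      ≈⟨ sumK-cong (upTo q₁) (λ n → trans (sumK-*ʳ (upTo m) _ _) (*-congʳ
           (ψ₂.twist m (q₁ ℕ.* t) m≡[q₁t]q₂ a d (+ m₁ ℤ.* + n) ad≅1 (shift n) (κ ∘ h)))) ⟩
    ∑ q₁ (λ n → ψ₂ d * ψ₂.moment m h * (ψ₁ (+ n) * κ (g n)))
      ≈⟨ sumK-*ˡ (upTo q₁) _ _ ⟩
    ψ₂ d * ψ₂.moment m h * ψ₁.moment q₁ g ∎
    where
    lemma : ∀ q t n → q ℤ.* t ℤ.* n ≡ + 0 ℤ.+ t ℤ.* n ℤ.* q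
    lemma = solve-∀
    shift : ∀ n → + m₁ ℤ.* + n ≅ + 0 [ q₂ ]
    shift n = + t ℤ.* + n , ≡.trans (≡.cong (λ z → z ℤ.* + n) (ℤ.pos-* q₂ t)) (lemma (+ q₂) (+ t) (+ n))

  moment₁-const : ∀ k → ψ₁.moment q₁ (λ _ → k) ≈ 0#
  moment₁-const = ψ₁.moment-const-period

  moment₂-const : ∀ k → ψ₂.moment m (λ _ → k) ≈ 0#
  moment₂-const k rewrite m≡[q₁t]q₂ = ψ₂.moment-const (q₁ ℕ.* t) k

  ⟪⟫-first-only : ∀ f → ⟪ (λ j n → f j) ⟫ ≈ 0#
  ⟪⟫-first-only f = trans (⟪⟫-cong λ j n → ≡.sym (ℤ.*-identityʳ (f j)))
    (trans (⟪⟫-product f (λ _ → + 1)) (trans (*-congˡ (moment₁-const (+ 1))) (zeroʳ _)))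

  ⟪⟫-second-only : ∀ g → ⟪ (λ j n → g n) ⟫ ≈ 0#
  ⟪⟫-second-only g = trans (⟪⟫-cong λ j n → ≡.sym (ℤ.*-identityˡ (g n)))
    (trans (⟪⟫-product (λ _ → + 1) g) (trans (*-congʳ (moment₂-const (+ 1))) (zeroˡ _)))

  ⟪⟫-residue-only : ∀ (h : ℕ → ℤ) → ⟪ (λ j n → h (x j n %ℕ m)) ⟫ ≈ 0#
  ⟪⟫-residue-only h = trans (⟪⟫-cong λ j n → ≡.sym (ℤ.*-identityʳ (h (x j n %ℕ m))))
    (trans (⟪⟫-residue h (λ _ → + 1)) (trans (*-congˡ (moment₁-const (+ 1))) (zeroʳ _)))

  module _ (even : ψ₁ -[1+ 0 ] * ψ₂ -[1+ 0 ] ≈ 1#) where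

    -- Reflecting both variables at once costs ψ₁(-1) ψ₂(-1), which is 1 by parity.
    ⟪⟫-reflect : ∀ z → ⟪ (λ j n → z (neg m j) (neg q₁ n)) ⟫ ≈ ⟪ z ⟫
    ⟪⟫-reflect z = begin
      ∑ m (λ j → ψ₂ (+ j) * ∑ q₁ (λ n → ψ₁ (+ n) * κ (z (neg m j) (neg q₁ n))))
        ≈⟨ sumK-cong (upTo m) (λ j → *-congˡ (ψ₁.reflect q₁ 1 (≡.sym (ℕ.*-identityˡ q₁)) (λ n → κ (z (neg m j) n)))) ⟩
      ∑ m (λ j → ψ₂ (+ j) * (ψ₁ -[1+ 0 ] * ψ₁.moment q₁ (z (neg m j))))
        ≈⟨ ψ₂.reflect m (q₁ ℕ.* t) m≡[q₁t]q₂ (λ j → ψ₁ -[1+ 0 ] * ψ₁.moment q₁ (z j)) ⟩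
      ψ₂ -[1+ 0 ] * ∑ m (λ j → ψ₂ (+ j) * (ψ₁ -[1+ 0 ] * ψ₁.moment q₁ (z j)))
        ≈⟨ *-congˡ (trans (sumK-cong (upTo m) λ j →
             solve 3 (λ w e s → w :* (e :* s) := e :* (w :* s)) refl (ψ₂ (+ j)) (ψ₁ -[1+ 0 ]) (ψ₁.moment q₁ (z j)))
             (sumK-*ˡ (upTo m) _ _)) ⟩
      ψ₂ -[1+ 0 ] * (ψ₁ -[1+ 0 ] * ⟪ z ⟫)
        ≈⟨ solve 3 (λ e₂ e₁ s → e₂ :* (e₁ :* s) := e₁ :* e₂ :* s) refl (ψ₂ -[1+ 0 ]) (ψ₁ -[1+ 0 ]) ⟪ z ⟫ ⟩
      ψ₁ -[1+ 0 ] * ψ₂ -[1+ 0 ] * ⟪ z ⟫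
        ≈⟨ trans (*-congʳ even) (*-identityˡ _) ⟩
      ⟪ z ⟫ ∎

    r⁻ : ℕ → ℕ → ℤ
    r⁻ j n = + ((ℤ.- x j n) %ℕ m)

    -- Shows `r⁻` to be a function of the residue of x alone, so that by itself it sums to 0.
    r⁻-residue : ∀ j n → r⁻ j n ≡ + neg m (x j n %ℕ m)
    r⁻-residue j n = ≡.cong +_ (%ℕ-cong m (≅-neg (≅-sym (%ℕ-≅ m (x j n)))))

    r⁻-reflect : ∀ j n → r⁻ (neg m j) (neg q₁ n) ≡ r j n
    r⁻-reflect j n = ≡.cong +_ (%ℕ-cong m (≅-trans
      (≅-neg (≅-+ (≅-*ˡ a (%ℕ-≅ m (ℤ.- + j))) scaled))
      (≅-reflexive (lemma a (+ j) (+ m₁) (+ n)))))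
      where
      -- Reflecting n mod q₁ is enough: the factor m₁ raises the modulus to m₁ q₁ = m.
      scaled : + m₁ ℤ.* + neg q₁ n ≅ + m₁ ℤ.* ℤ.- + n [ m ]
      scaled = ≡.subst (λ k → + m₁ ℤ.* + neg q₁ n ≅ + m₁ ℤ.* ℤ.- + n [ k ]) (ℕ.*-comm m₁ q₁)
        (≅-scale m₁ (%ℕ-≅ q₁ (ℤ.- + n)))
      lemma : ∀ a j m n → ℤ.- (a ℤ.* ℤ.- j ℤ.+ m ℤ.* ℤ.- n) ≡ a ℤ.* j ℤ.+ m ℤ.* n
      lemma = solve-∀

    -- The term j = 0, where the reflection of j is 0 rather than m, has weight ψ₂(0) = 0.
    ⟪⟫-neg : ∀ (f : ℤ → ℤ → ℕ → ℕ → ℤ) →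
      ⟪ (λ j n → f (+ j) (+ neg m j) j n) ⟫ ≈ ⟪ (λ j n → f (+ j) (+ m ℤ.- + j) j n) ⟫
    ⟪⟫-neg f = ∑-cong m λ where
      zero    _   → trans (trans (*-congʳ ψ₂.at-zero) (zeroˡ _)) (sym (trans (*-congʳ ψ₂.at-zero) (zeroˡ _)))
      (suc j) j<m → *-congˡ (sumK-cong (upTo q₁) λ n → *-congˡ (reflexive (≡.cong (λ y → κ (f (+ suc j) y (suc j) n)) (neg-pos m j<m))))

    jr : Carrier
    jr = ⟪ (λ j n → + j ℤ.* r j n) ⟫

    -- The double reflection turns j r⁻ into (m - j) r, and m r sums to 0.
    ⟪jr⁻⟫ : ⟪ (λ j n → + j ℤ.* r⁻ j n) ⟫ ≈ - jr
    ⟪jr⁻⟫ = begin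
      ⟪ (λ j n → + j ℤ.* r⁻ j n) ⟫
        ≈⟨ ⟪⟫-reflect (λ j n → + j ℤ.* r⁻ j n) ⟨
      ⟪ (λ j n → + neg m j ℤ.* r⁻ (neg m j) (neg q₁ n)) ⟫
        ≈⟨ ⟪⟫-cong (λ j n → ≡.cong (λ y → + neg m j ℤ.* y) (r⁻-reflect j n)) ⟩
      ⟪ (λ j n → + neg m j ℤ.* r j n) ⟫
        ≈⟨ ⟪⟫-neg (λ _ j⁻ j n → j⁻ ℤ.* r j n) ⟩
      ⟪ (λ j n → (+ m ℤ.- + j) ℤ.* r j n) ⟫
        ≈⟨ ⟪⟫-cong (λ j n → lemma (+ m) (+ j) (r j n)) ⟩
      ⟪ (λ j n → + m ℤ.* r j n ℤ.+ -[1+ 0 ] ℤ.* (+ j ℤ.* r j n)) ⟫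
        ≈⟨ ⟪⟫-+ (λ j n → + m ℤ.* r j n) _ ⟩
      ⟪ (λ j n → + m ℤ.* r j n) ⟫ + ⟪ (λ j n → -[1+ 0 ] ℤ.* (+ j ℤ.* r j n)) ⟫
        ≈⟨ +-cong (⟪⟫-residue-only (λ k → + m ℤ.* + k)) (⟪⟫-*ˡ -[1+ 0 ] (λ j n → + j ℤ.* r j n)) ⟩
      0# + κ -[1+ 0 ] * jr
        ≈⟨ solve 1 (λ s → con (+ 0) :+ con -[1+ 0 ] :* s := :- s) refl jr ⟩
      - jr ∎
      where
      lemma : ∀ m j r → (m ℤ.- j) ℤ.* r ≡ m ℤ.* r ℤ.+ -[1+ 0 ] ℤ.* (j ℤ.* r)
      lemma = solve-∀

    instance
      q₁m≢0 : ℕ.NonZero (q₁ ℕ.* m)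
      q₁m≢0 = ℕ.m*n≢0 q₁ m

    B1-fraction : ∀ j n → κ (+ (2 ℕ.* (q₁ ℕ.* m))) * B1 K (+ n ℤ.* + m ℤ.+ a ℤ.* + j ℤ.* + q₁) (q₁ ℕ.* m)
      ≈ κ (+ q₁ ℤ.* (r j n ℤ.- r⁻ j n))
    B1-fraction j n = begin
      κ (+ (2 ℕ.* (q₁ ℕ.* m))) * B1 K y (q₁ ℕ.* m)
        ≈⟨ B1-scaled (q₁ ℕ.* m) y ⟩
      κ (+ (y %ℕ (q₁ ℕ.* m)) ℤ.- + ((ℤ.- y) %ℕ (q₁ ℕ.* m)))
        ≡⟨ ≡.cong₂ (λ u v → κ (+ u ℤ.- + v)) first second ⟩
      κ (+ (q₁ ℕ.* (x j n %ℕ m)) ℤ.- + (q₁ ℕ.* ((ℤ.- x j n) %ℕ m)))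
        ≡⟨ ≡.cong κ (≡.trans (≡.cong₂ ℤ._-_ (ℤ.pos-* q₁ _) (ℤ.pos-* q₁ _)) (lemma′ (+ q₁) (r j n) (r⁻ j n))) ⟩
      κ (+ q₁ ℤ.* (r j n ℤ.- r⁻ j n)) ∎
      where
      y : ℤ
      y = + n ℤ.* + m ℤ.+ a ℤ.* + j ℤ.* + q₁
      lemma : ∀ n q m₁ a j → n ℤ.* (q ℤ.* m₁) ℤ.+ a ℤ.* j ℤ.* q ≡ q ℤ.* (a ℤ.* j ℤ.+ m₁ ℤ.* n)
      lemma = solve-∀
      lemma′ : ∀ q u v → q ℤ.* u ℤ.- q ℤ.* v ≡ q ℤ.* (u ℤ.- v)
      lemma′ = solve-∀
      y≡q₁x : y ≡ + q₁ ℤ.* x j n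
      y≡q₁x = ≡.trans (≡.cong (λ z → + n ℤ.* z ℤ.+ a ℤ.* + j ℤ.* + q₁) m≡q₁m₁) (lemma (+ n) (+ q₁) (+ m₁) a (+ j))
      first : y %ℕ (q₁ ℕ.* m) ≡ q₁ ℕ.* (x j n %ℕ m)
      first = ≡.trans (≡.cong (λ z → z %ℕ (q₁ ℕ.* m)) y≡q₁x) (scale-%ℕ q₁ m (x j n))
      second : (ℤ.- y) %ℕ (q₁ ℕ.* m) ≡ q₁ ℕ.* ((ℤ.- x j n) %ℕ m)
      second = ≡.trans (≡.cong (λ z → z %ℕ (q₁ ℕ.* m)) (≡.trans (≡.cong ℤ.-_ y≡q₁x) (ℤ.neg-distribʳ-* (+ q₁) (x j n))))
        (scale-%ℕ q₁ m (ℤ.- x j n))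

    -- Follows the shape of `Sac`, so that for conjugate characters the two agree by definition.
    S : Carrier
    S = ∑ m λ j → ∑ q₁ λ n →
      ψ₂ (+ j) * ψ₁ (+ n) * B1 K (+ j) m * B1 K (+ n ℤ.* + m ℤ.+ a ℤ.* + j ℤ.* + q₁) (q₁ ℕ.* m)

    S-scaled : κ (+ (2 ℕ.* m)) * κ (+ (2 ℕ.* (q₁ ℕ.* m))) * S
             ≈ ⟪ (λ j n → (+ j ℤ.- + neg m j) ℤ.* (+ q₁ ℤ.* (r j n ℤ.- r⁻ j n))) ⟫
    S-scaled = trans (sym (sumK-*ˡ (upTo m) _ _)) (∑-cong m λ j j<m → begin
      u * v * ∑ q₁ (λ n → ψ₂ (+ j) * ψ₁ (+ n) * B1 K (+ j) m * B′ j n)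
        ≈⟨ sumK-*ˡ (upTo q₁) _ _ ⟨
      ∑ q₁ (λ n → u * v * (ψ₂ (+ j) * ψ₁ (+ n) * B1 K (+ j) m * B′ j n))
        ≈⟨ sumK-cong (upTo q₁) (λ n → trans
             (solve 6 (λ u v w₂ w₁ b b′ → u :* v :* (w₂ :* w₁ :* b :* b′) := w₂ :* (w₁ :* ((u :* b) :* (v :* b′)))) refl
                u v (ψ₂ (+ j)) (ψ₁ (+ n)) (B1 K (+ j) m) (B′ j n))
             (*-congˡ (*-congˡ (trans (*-cong (first j j<m) (B1-fraction j n)) (sym (κ-* (+ j ℤ.- + neg m j) (+ q₁ ℤ.* (r j n ℤ.- r⁻ j n)))))))) ⟩
      ∑ q₁ (λ n → ψ₂ (+ j) * (ψ₁ (+ n) * κ ((+ j ℤ.- + neg m j) ℤ.* (+ q₁ ℤ.* (r j n ℤ.- r⁻ j n)))))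
        ≈⟨ sumK-*ˡ (upTo q₁) _ _ ⟩
      _ ∎)
      where
      u v : Carrier
      u = κ (+ (2 ℕ.* m))
      v = κ (+ (2 ℕ.* (q₁ ℕ.* m)))
      B′ : ℕ → ℕ → Carrier
      B′ j n = B1 K (+ n ℤ.* + m ℤ.+ a ℤ.* + j ℤ.* + q₁) (q₁ ℕ.* m)
      first : ∀ j → j ℕ.< m → u * B1 K (+ j) m ≈ κ (+ j ℤ.- + neg m j)
      first j j<m = trans (B1-scaled m (+ j)) (reflexive (≡.cong (λ k → κ (+ k ℤ.- + neg m j)) ([+m]%ℕ m j<m)))

    -- B₁(y) = ({y} − {−y})/2, and every one of the four products of
    -- fractional parts contributes equally.
    m²S≈jr : κ (+ m ℤ.* + m) * S ≈ jr
    -- (2 m)(2 q₁ m) = 4 q₁ m² clears the denominators of the two B₁ factors.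
    m²S≈jr = cancel (κ-pos≉0 (4 ℕ.* q₁) {{ℕ.m*n≢0 4 q₁}}) (begin
      κ (+ (4 ℕ.* q₁)) * (κ (+ m ℤ.* + m) * S)
        ≈⟨ *-assoc _ _ _ ⟨
      κ (+ (4 ℕ.* q₁)) * κ (+ m ℤ.* + m) * S
        ≈⟨ *-congʳ (trans (sym (κ-* (+ (4 ℕ.* q₁)) (+ m ℤ.* + m))) (trans (reflexive (≡.cong κ scalars)) (κ-* (+ (2 ℕ.* m)) (+ (2 ℕ.* (q₁ ℕ.* m)))))) ⟩
      κ (+ (2 ℕ.* m)) * κ (+ (2 ℕ.* (q₁ ℕ.* m))) * S
        ≈⟨ S-scaled ⟩
      ⟪ (λ j n → (+ j ℤ.- + neg m j) ℤ.* (+ q₁ ℤ.* (r j n ℤ.- r⁻ j n))) ⟫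
        ≈⟨ ⟪⟫-neg (λ y y⁻ j n → (y ℤ.- y⁻) ℤ.* (+ q₁ ℤ.* (r j n ℤ.- r⁻ j n))) ⟩
      ⟪ (λ j n → (+ j ℤ.- (+ m ℤ.- + j)) ℤ.* (+ q₁ ℤ.* (r j n ℤ.- r⁻ j n))) ⟫
        ≈⟨ ⟪⟫-cong (λ j n → expand (+ j) (+ m) (+ q₁) (r j n) (r⁻ j n) _ (r⁻-residue j n)) ⟩
      ⟪ (λ j n → + q₁ ℤ.* (+ 2 ℤ.* (+ j ℤ.* r j n) ℤ.+ (-[1+ 1 ] ℤ.* (+ j ℤ.* r⁻ j n) ℤ.+ rest (x j n %ℕ m)))) ⟫
        ≈⟨ ⟪⟫-*ˡ (+ q₁) _ ⟩
      κ (+ q₁) * ⟪ (λ j n → + 2 ℤ.* (+ j ℤ.* r j n) ℤ.+ (-[1+ 1 ] ℤ.* (+ j ℤ.* r⁻ j n) ℤ.+ rest (x j n %ℕ m))) ⟫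
        ≈⟨ *-congˡ (trans (⟪⟫-+ (λ j n → + 2 ℤ.* (+ j ℤ.* r j n)) _) (+-cong (⟪⟫-*ˡ (+ 2) (λ j n → + j ℤ.* r j n))
             (trans (⟪⟫-+ (λ j n → -[1+ 1 ] ℤ.* (+ j ℤ.* r⁻ j n)) _)
               (+-cong (trans (⟪⟫-*ˡ -[1+ 1 ] (λ j n → + j ℤ.* r⁻ j n)) (*-congˡ ⟪jr⁻⟫)) (⟪⟫-residue-only rest))))) ⟩
      κ (+ q₁) * (κ (+ 2) * jr + (κ -[1+ 1 ] * - jr + 0#))
        ≈⟨ solve 2 (λ q s → q :* (con (+ 2) :* s :+ (con -[1+ 1 ] :* :- s :+ con (+ 0))) := con (+ 4) :* q :* s) refl (κ (+ q₁)) jr ⟩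
      κ (+ 4) * κ (+ q₁) * jr
        ≈⟨ *-congʳ (trans (sym (κ-* (+ 4) (+ q₁))) (reflexive (≡.cong κ (≡.sym (ℤ.pos-* 4 q₁))))) ⟩
      κ (+ (4 ℕ.* q₁)) * jr ∎)
      where
      rest : ℕ → ℤ
      rest k = + m ℤ.* (+ neg m k ℤ.- + k)
      -- Only the last `r⁻` is rewritten through the residue, which makes that term visibly a
      -- function of the residue; the one multiplied by j is kept for `⟪jr⁻⟫`.
      expand : ∀ j m q r r⁻ s → r⁻ ≡ s →
        (j ℤ.- (m ℤ.- j)) ℤ.* (q ℤ.* (r ℤ.- r⁻))
        ≡ q ℤ.* (+ 2 ℤ.* (j ℤ.* r) ℤ.+ (-[1+ 1 ] ℤ.* (j ℤ.* r⁻) ℤ.+ m ℤ.* (s ℤ.- r)))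
      expand j m q r r⁻ .r⁻ ≡.refl = lemma j m q r r⁻
        where
        lemma : ∀ j m q r r⁻ → (j ℤ.- (m ℤ.- j)) ℤ.* (q ℤ.* (r ℤ.- r⁻))
          ≡ q ℤ.* (+ 2 ℤ.* (j ℤ.* r) ℤ.+ (-[1+ 1 ] ℤ.* (j ℤ.* r⁻) ℤ.+ m ℤ.* (r⁻ ℤ.- r)))
        lemma = solve-∀
      scalars : + (4 ℕ.* q₁) ℤ.* (+ m ℤ.* + m) ≡ + (2 ℕ.* m) ℤ.* + (2 ℕ.* (q₁ ℕ.* m))
      scalars = ≡.trans (≡.cong (λ z → z ℤ.* (+ m ℤ.* + m)) (ℤ.pos-* 4 q₁)) (≡.trans (lemma (+ q₁) (+ m))
        (≡.sym (≡.cong₂ ℤ._*_ (ℤ.pos-* 2 m) (≡.trans (ℤ.pos-* 2 (q₁ ℕ.* m)) (≡.cong (λ z → + 2 ℤ.* z) (ℤ.pos-* q₁ m))))))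
        where
        lemma : ∀ q m → + 4 ℤ.* q ℤ.* (m ℤ.* m) ≡ + 2 ℤ.* m ℤ.* (+ 2 ℤ.* (q ℤ.* m))
        lemma = solve-∀

    -- m fl = a j + m₁ n - r, and each of the three terms depends on j, on n or on the residue
    -- alone.
    ⟪fl⟫ : ⟪ fl ⟫ ≈ 0#
    ⟪fl⟫ = cancel (κ-pos≉0 m) (begin
      κ (+ m) * ⟪ fl ⟫
        ≈⟨ ⟪⟫-*ˡ (+ m) fl ⟨
      ⟪ (λ j n → + m ℤ.* fl j n) ⟫
        ≈⟨ ⟪⟫-cong (λ j n → split (a ℤ.* + j) (+ m₁ ℤ.* + n) (r j n) (fl j n) (+ m) (x-division j n)) ⟩
      ⟪ (λ j n → a ℤ.* + j ℤ.+ (+ m₁ ℤ.* + n ℤ.+ ℤ.- r j n)) ⟫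
        ≈⟨ trans (⟪⟫-+ (λ j n → a ℤ.* + j) _) (+-cong (⟪⟫-first-only (λ j → a ℤ.* + j))
             (trans (⟪⟫-+ (λ j n → + m₁ ℤ.* + n) (λ j n → ℤ.- r j n))
               (+-cong (⟪⟫-second-only (λ n → + m₁ ℤ.* + n)) (⟪⟫-residue-only (λ k → ℤ.- + k))))) ⟩
      0# + (0# + 0#)
        ≈⟨ trans (+-identityˡ _) (+-identityˡ _) ⟩
      0#
        ≈⟨ zeroʳ _ ⟨
      κ (+ m) * 0# ∎)
      where
      split : ∀ u v r f m → u ℤ.+ v ≡ r ℤ.+ f ℤ.* m → m ℤ.* f ≡ u ℤ.+ (v ℤ.+ ℤ.- r)
      split u v r f m eq = ≡.trans (lemma r f m) (≡.trans (≡.cong (λ z → z ℤ.- r) (≡.sym eq)) (lemma′ u v r))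
        where
        lemma : ∀ r f m → m ℤ.* f ≡ r ℤ.+ f ℤ.* m ℤ.- r
        lemma = solve-∀
        lemma′ : ∀ u v r → u ℤ.+ v ℤ.- r ≡ u ℤ.+ (v ℤ.+ ℤ.- r)
        lemma′ = solve-∀

    -- In terms of generalised Bernoulli numbers this is q₁ q₂ B_{1,ψ₁} B_{1,ψ₂}.
    β : Carrier
    β = ψ₂.moment q₂ (+_) * ψ₁.moment q₁ (+_)

    ⟪jn⟫ : ⟪ (λ j n → + j ℤ.* + n) ⟫ ≈ κ (+ (q₁ ℕ.* t)) * β
    ⟪jn⟫ = trans (⟪⟫-product (+_) (+_)) (trans (*-congʳ first) (*-assoc _ _ _))
      where
      first : ψ₂.moment m (+_) ≈ κ (+ (q₁ ℕ.* t)) * ψ₂.moment q₂ (+_)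
      first rewrite m≡[q₁t]q₂ = ψ₂.first-moment (q₁ ℕ.* t)

    tri : ℕ → ℕ → ℤ
    tri j n = proj₁ (square-parity (fl j n))

    -- `σ` is 1 when γ itself is used and -1 when -γ is. `d-eigen` asks ψ₂(d) to act as `σ` on the
    -- first moment only.
    module _ (σ s : ℤ) (a≡σ : a ≡ σ ℤ.+ + q₁ ℤ.* + q₂ ℤ.* s)
      (d-eigen : ψ₂ d * ψ₂.moment m (+_) ≈ κ σ * ψ₂.moment m (+_)) where

      -- m fl n = a j n + m₁ n² - r n, where the middle term sums to 0 and ⟪r n⟫ = σ ⟪j n⟫. What
      -- remains is (a - σ) ⟪j n⟫ = q₁ q₂ s · q₁ t β = m · q₁ s β.
      ⟪fl*n⟫ : ⟪ (λ j n → fl j n ℤ.* + n) ⟫ ≈ κ (+ q₁ ℤ.* s) * β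
      ⟪fl*n⟫ = cancel (κ-pos≉0 m) (begin
        κ (+ m) * ⟪ (λ j n → fl j n ℤ.* + n) ⟫
          ≈⟨ ⟪⟫-*ˡ (+ m) (λ j n → fl j n ℤ.* + n) ⟨
        ⟪ (λ j n → + m ℤ.* (fl j n ℤ.* + n)) ⟫
          ≈⟨ ⟪⟫-cong (λ j n → split a (+ j) (+ m₁) (+ n) (r j n) (fl j n) (+ m) (x-division j n)) ⟩
        ⟪ (λ j n → a ℤ.* (+ j ℤ.* + n) ℤ.+ (+ m₁ ℤ.* (+ n ℤ.* + n) ℤ.+ ℤ.- r j n ℤ.* + n)) ⟫
          ≈⟨ trans (⟪⟫-+ (λ j n → a ℤ.* (+ j ℤ.* + n)) _) (+-cong (⟪⟫-*ˡ a (λ j n → + j ℤ.* + n))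
               (trans (⟪⟫-+ (λ j n → + m₁ ℤ.* (+ n ℤ.* + n)) (λ j n → ℤ.- r j n ℤ.* + n))
                 (+-cong (⟪⟫-second-only (λ n → + m₁ ℤ.* (+ n ℤ.* + n))) residue))) ⟩
        κ a * jn + (0# + - (κ σ * jn))
          ≈⟨ +-congʳ (*-congʳ (trans (reflexive (≡.cong κ a≡σ)) (κ-+ σ _))) ⟩
        (κ σ + κ (+ q₁ ℤ.* + q₂ ℤ.* s)) * jn + (0# + - (κ σ * jn))
          ≈⟨ solve 3 (λ σ k z → (σ :+ k) :* z :+ (con (+ 0) :+ :- (σ :* z)) := k :* z) refl (κ σ) (κ (+ q₁ ℤ.* + q₂ ℤ.* s)) jn ⟩
        κ (+ q₁ ℤ.* + q₂ ℤ.* s) * jn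
          ≈⟨ *-congˡ ⟪jn⟫ ⟩
        κ (+ q₁ ℤ.* + q₂ ℤ.* s) * (κ (+ (q₁ ℕ.* t)) * β)
          ≈⟨ trans (sym (*-assoc _ _ _)) (trans (*-congʳ (sym (κ-* (+ q₁ ℤ.* + q₂ ℤ.* s) (+ (q₁ ℕ.* t)))))
               (trans (*-congʳ (trans (reflexive (≡.cong κ scalars)) (κ-* (+ m) (+ q₁ ℤ.* s)))) (*-assoc _ _ _))) ⟩
        κ (+ m) * (κ (+ q₁ ℤ.* s) * β) ∎)
        where
        jn : Carrier
        jn = ⟪ (λ j n → + j ℤ.* + n) ⟫
        split : ∀ a j m₁ n r f m → a ℤ.* j ℤ.+ m₁ ℤ.* n ≡ r ℤ.+ f ℤ.* m →
          m ℤ.* (f ℤ.* n) ≡ a ℤ.* (j ℤ.* n) ℤ.+ (m₁ ℤ.* (n ℤ.* n) ℤ.+ ℤ.- r ℤ.* n)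
        split a j m₁ n r f m eq = ≡.trans (lemma r f m n)
          (≡.trans (≡.cong (λ z → (z ℤ.- r) ℤ.* n) (≡.sym eq)) (lemma′ a j m₁ n r))
          where
          lemma : ∀ r f m n → m ℤ.* (f ℤ.* n) ≡ (r ℤ.+ f ℤ.* m ℤ.- r) ℤ.* n
          lemma = solve-∀
          lemma′ : ∀ a j m₁ n r → (a ℤ.* j ℤ.+ m₁ ℤ.* n ℤ.- r) ℤ.* n
            ≡ a ℤ.* (j ℤ.* n) ℤ.+ (m₁ ℤ.* (n ℤ.* n) ℤ.+ ℤ.- r ℤ.* n)
          lemma′ = solve-∀
        residue : ⟪ (λ j n → ℤ.- r j n ℤ.* + n) ⟫ ≈ - (κ σ * jn)
        residue = begin
          ⟪ (λ j n → ℤ.- r j n ℤ.* + n) ⟫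
            ≈⟨ ⟪⟫-cong (λ j n → lemma (r j n) (+ n)) ⟩
          ⟪ (λ j n → -[1+ 0 ] ℤ.* (r j n ℤ.* + n)) ⟫
            ≈⟨ trans (⟪⟫-*ˡ -[1+ 0 ] (λ j n → r j n ℤ.* + n)) (*-congˡ (⟪⟫-residue (+_) (+_))) ⟩
          κ -[1+ 0 ] * (ψ₂ d * ψ₂.moment m (+_) * ψ₁.moment q₁ (+_))
            ≈⟨ *-congˡ (trans (*-congʳ d-eigen) (trans (*-assoc _ _ _) (*-congˡ (sym (⟪⟫-product (+_) (+_)))))) ⟩
          κ -[1+ 0 ] * (κ σ * jn)
            ≈⟨ solve 1 (λ z → con -[1+ 0 ] :* z := :- z) refl (κ σ * jn) ⟩
          - (κ σ * jn) ∎
          where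
          lemma : ∀ r n → ℤ.- r ℤ.* n ≡ -[1+ 0 ] ℤ.* (r ℤ.* n)
          lemma = solve-∀
        scalars : + q₁ ℤ.* + q₂ ℤ.* s ℤ.* + (q₁ ℕ.* t) ≡ + m ℤ.* (+ q₁ ℤ.* s)
        scalars = ≡.trans (≡.cong (λ z → + q₁ ℤ.* + q₂ ℤ.* s ℤ.* z) (ℤ.pos-* q₁ t))
          (≡.trans (lemma (+ q₁) (+ q₂) s (+ t)) (≡.cong (λ z → z ℤ.* (+ q₁ ℤ.* s))
            (≡.sym (≡.trans m≡q₁m₁ (≡.cong (λ z → + q₁ ℤ.* z) (ℤ.pos-* q₂ t))))))
          where
          lemma : ∀ q₁ q₂ s t → q₁ ℤ.* q₂ ℤ.* s ℤ.* (q₁ ℤ.* t) ≡ q₁ ℤ.* (q₂ ℤ.* t) ℤ.* (q₁ ℤ.* s)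
          lemma = solve-∀

      -- 2 a j r = (a j)² + r² − (a j − r)² with a j − r = m fl − m₁ n, so only
      -- the terms in fl² and fl·n survive summation.
      aS : κ a * S ≈ κ s * β - ⟪ tri ⟫
      aS = cancel {κ (+ 2) * κ (+ m ℤ.* + m)} 2m²≉0 (begin
        κ (+ 2) * κ (+ m ℤ.* + m) * (κ a * S)
          ≈⟨ solve 4 (λ u v w z → u :* v :* (w :* z) := u :* w :* (v :* z)) refl (κ (+ 2)) (κ (+ m ℤ.* + m)) (κ a) S ⟩
        κ (+ 2) * κ a * (κ (+ m ℤ.* + m) * S)
          ≈⟨ *-cong (sym (κ-* (+ 2) a)) m²S≈jr ⟩
        κ (+ 2 ℤ.* a) * jr
          ≈⟨ ⟪⟫-*ˡ (+ 2 ℤ.* a) (λ j n → + j ℤ.* r j n) ⟨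
        ⟪ (λ j n → + 2 ℤ.* a ℤ.* (+ j ℤ.* r j n)) ⟫
          ≈⟨ ⟪⟫-cong (λ j n → polarise a (+ j) (+ m₁) (+ n) (r j n) (fl j n) (+ m) (tri j n) (x-division j n) (proj₂ (square-parity (fl j n)))) ⟩
        ⟪ (λ j n → f₁ j ℤ.+ (f₂ (x j n %ℕ m) ℤ.+ (f₃ n ℤ.+ (k₄ ℤ.* fl j n ℤ.+ (k₅ ℤ.* tri j n ℤ.+ k₆ ℤ.* (fl j n ℤ.* + n)))))) ⟫
          ≈⟨ trans (⟪⟫-+ (λ j n → f₁ j) _) (+-cong (⟪⟫-first-only f₁)
              (trans (⟪⟫-+ (λ j n → f₂ (x j n %ℕ m)) _) (+-cong (⟪⟫-residue-only f₂)
              (trans (⟪⟫-+ (λ j n → f₃ n) _) (+-cong (⟪⟫-second-only f₃)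
              (trans (⟪⟫-+ (λ j n → k₄ ℤ.* fl j n) _) (+-cong (trans (⟪⟫-*ˡ k₄ fl) (*-congˡ ⟪fl⟫))
              (trans (⟪⟫-+ (λ j n → k₅ ℤ.* tri j n) (λ j n → k₆ ℤ.* (fl j n ℤ.* + n)))
                (+-cong (⟪⟫-*ˡ k₅ tri) (trans (⟪⟫-*ˡ k₆ (λ j n → fl j n ℤ.* + n)) (*-congˡ ⟪fl*n⟫))))))))))) ⟩
        0# + (0# + (0# + (κ k₄ * 0# + (κ k₅ * ⟪ tri ⟫ + κ k₆ * (κ (+ q₁ ℤ.* s) * β)))))
          ≈⟨ +-congˡ (+-congˡ (+-congˡ (+-congˡ (+-cong (*-congʳ κ-k₅) (trans (sym (*-assoc _ _ _)) (trans (*-congʳ κ-k₆) (*-assoc _ _ _))))))) ⟩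
        0# + (0# + (0# + (κ k₄ * 0# + (- (κ (+ 2) * κ (+ m ℤ.* + m)) * ⟪ tri ⟫ + κ (+ 2) * κ (+ m ℤ.* + m) * (κ s * β)))))
          ≈⟨ solve 4 (λ k u y z → con (+ 0) :+ (con (+ 0) :+ (con (+ 0) :+ (k :* con (+ 0) :+ (:- u :* y :+ u :* z)))) := u :* (z :- y)) refl
               (κ k₄) (κ (+ 2) * κ (+ m ℤ.* + m)) ⟪ tri ⟫ (κ s * β) ⟩
        κ (+ 2) * κ (+ m ℤ.* + m) * (κ s * β - ⟪ tri ⟫) ∎)
        where
        f₁ f₂ f₃ : ℕ → ℤ
        f₁ j = a ℤ.* + j ℤ.* (a ℤ.* + j)
        f₂ k = + k ℤ.* + k
        f₃ n = ℤ.- (+ m₁ ℤ.* + n ℤ.* (+ m₁ ℤ.* + n))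
        k₄ k₅ k₆ : ℤ
        k₄ = ℤ.- (+ m ℤ.* + m)
        k₅ = ℤ.- (+ 2 ℤ.* (+ m ℤ.* + m))
        k₆ = + 2 ℤ.* (+ m ℤ.* + m₁)
        2m²≉0 : ¬ (κ (+ 2) * κ (+ m ℤ.* + m) ≈ 0#)
        2m²≉0 eq = κ-pos≉0 (2 ℕ.* (m ℕ.* m)) {{ℕ.m*n≢0 2 (m ℕ.* m) {{_}} {{ℕ.m*n≢0 m m}}}}
          (trans (trans (reflexive (≡.cong κ (≡.trans (ℤ.pos-* 2 (m ℕ.* m)) (≡.cong (λ z → + 2 ℤ.* z) (ℤ.pos-* m m))))) (κ-* (+ 2) (+ m ℤ.* + m))) eq)
        κ-k₅ : κ k₅ ≈ - (κ (+ 2) * κ (+ m ℤ.* + m))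
        κ-k₅ = trans (κ-neg (+ 2 ℤ.* (+ m ℤ.* + m))) (-‿cong (κ-* (+ 2) (+ m ℤ.* + m)))
        -- The q₁ in the value of `⟪fl*n⟫` completes m₁ to m, so that 2 m² can be cancelled from
        -- this term too.
        κ-k₆ : κ k₆ * κ (+ q₁ ℤ.* s) ≈ κ (+ 2) * κ (+ m ℤ.* + m) * κ s
        κ-k₆ = begin
          κ k₆ * κ (+ q₁ ℤ.* s)                    ≈⟨ κ-* k₆ (+ q₁ ℤ.* s) ⟨
          κ (k₆ ℤ.* (+ q₁ ℤ.* s))                  ≡⟨ ≡.cong κ (lemma (+ m) (+ m₁) (+ q₁) s) ⟩
          κ (+ 2 ℤ.* (+ m ℤ.* (+ q₁ ℤ.* + m₁)) ℤ.* s) ≡⟨ ≡.cong (λ z → κ (+ 2 ℤ.* (+ m ℤ.* z) ℤ.* s)) m≡q₁m₁ ⟨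
          κ (+ 2 ℤ.* (+ m ℤ.* + m) ℤ.* s)          ≈⟨ trans (κ-* (+ 2 ℤ.* (+ m ℤ.* + m)) s) (*-congʳ (κ-* (+ 2) (+ m ℤ.* + m))) ⟩
          κ (+ 2) * κ (+ m ℤ.* + m) * κ s          ∎
          where
          lemma : ∀ m m₁ q s → + 2 ℤ.* (m ℤ.* m₁) ℤ.* (q ℤ.* s) ≡ + 2 ℤ.* (m ℤ.* (q ℤ.* m₁)) ℤ.* s
          lemma = solve-∀
        polarise : ∀ a j m₁ n r f m τ → a ℤ.* j ℤ.+ m₁ ℤ.* n ≡ r ℤ.+ f ℤ.* m → f ℤ.* f ≡ f ℤ.+ + 2 ℤ.* τ →
          + 2 ℤ.* a ℤ.* (j ℤ.* r) ≡ a ℤ.* j ℤ.* (a ℤ.* j) ℤ.+ (r ℤ.* r ℤ.+ (ℤ.- (m₁ ℤ.* n ℤ.* (m₁ ℤ.* n)) ℤ.+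
            (ℤ.- (m ℤ.* m) ℤ.* f ℤ.+ (ℤ.- (+ 2 ℤ.* (m ℤ.* m)) ℤ.* τ ℤ.+ + 2 ℤ.* (m ℤ.* m₁) ℤ.* (f ℤ.* n)))))
        polarise a j m₁ n r f m τ eq parity = ≡.trans (lemma a j r (m₁ ℤ.* n))
          (≡.trans (≡.cong (λ z → a ℤ.* j ℤ.* (a ℤ.* j) ℤ.+ (r ℤ.* r ℤ.- (z ℤ.- r ℤ.- m₁ ℤ.* n) ℤ.* (z ℤ.- r ℤ.- m₁ ℤ.* n))) eq)
          (≡.trans (lemma′ a j m₁ n r f m)
          (≡.trans (≡.cong (λ z → a ℤ.* j ℤ.* (a ℤ.* j) ℤ.+ (r ℤ.* r ℤ.+ (ℤ.- (m₁ ℤ.* n ℤ.* (m₁ ℤ.* n)) ℤ.+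
            (ℤ.- (m ℤ.* m) ℤ.* z ℤ.+ + 2 ℤ.* (m ℤ.* m₁) ℤ.* (f ℤ.* n))))) parity)
          (lemma″ a j m₁ n r f m τ))))
          where
          lemma : ∀ a j r w → + 2 ℤ.* a ℤ.* (j ℤ.* r)
            ≡ a ℤ.* j ℤ.* (a ℤ.* j) ℤ.+ (r ℤ.* r ℤ.- (a ℤ.* j ℤ.+ w ℤ.- r ℤ.- w) ℤ.* (a ℤ.* j ℤ.+ w ℤ.- r ℤ.- w))
          lemma = solve-∀
          lemma′ : ∀ a j m₁ n r f m →
            a ℤ.* j ℤ.* (a ℤ.* j) ℤ.+ (r ℤ.* r ℤ.- (r ℤ.+ f ℤ.* m ℤ.- r ℤ.- m₁ ℤ.* n) ℤ.* (r ℤ.+ f ℤ.* m ℤ.- r ℤ.- m₁ ℤ.* n))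
            ≡ a ℤ.* j ℤ.* (a ℤ.* j) ℤ.+ (r ℤ.* r ℤ.+ (ℤ.- (m₁ ℤ.* n ℤ.* (m₁ ℤ.* n)) ℤ.+
            (ℤ.- (m ℤ.* m) ℤ.* (f ℤ.* f) ℤ.+ + 2 ℤ.* (m ℤ.* m₁) ℤ.* (f ℤ.* n))))
          lemma′ = solve-∀
          lemma″ : ∀ a j m₁ n r f m τ →
            a ℤ.* j ℤ.* (a ℤ.* j) ℤ.+ (r ℤ.* r ℤ.+ (ℤ.- (m₁ ℤ.* n ℤ.* (m₁ ℤ.* n)) ℤ.+
            (ℤ.- (m ℤ.* m) ℤ.* (f ℤ.+ + 2 ℤ.* τ) ℤ.+ + 2 ℤ.* (m ℤ.* m₁) ℤ.* (f ℤ.* n))))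
            ≡ a ℤ.* j ℤ.* (a ℤ.* j) ℤ.+ (r ℤ.* r ℤ.+ (ℤ.- (m₁ ℤ.* n ℤ.* (m₁ ℤ.* n)) ℤ.+
            (ℤ.- (m ℤ.* m) ℤ.* f ℤ.+ (ℤ.- (+ 2 ℤ.* (m ℤ.* m)) ℤ.* τ ℤ.+ + 2 ℤ.* (m ℤ.* m₁) ℤ.* (f ℤ.* n)))))
          lemma″ = solve-∀

      S-stable : CharacterRing.Stable K char₁ char₂ S
      S-stable = Stabilises-resp generators combination
        (Stabilises-+ generators
          (Stabilises-* generators (Stabilises-κ generators u) (Stabilises-resp generators (sym aS)
            (Stabilises-+ generators
              (Stabilises-* generators (Stabilises-κ generators s)
                (Stabilises-* generators (moment-stable char₂ ψ₂-stable q₂ (+_)) (moment-stable char₁ ψ₁-stable q₁ (+_))))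
              (Stabilises-resp generators (solve 1 (λ y → con -[1+ 0 ] :* y := :- y) refl ⟪ tri ⟫)
                (Stabilises-* generators (Stabilises-κ generators -[1+ 0 ]) (⟪⟫-stable tri))))))
          (Stabilises-* generators (Stabilises-κ generators (b ℤ.* b)) (Stabilises-resp generators (sym m²S≈jr)
            (⟪⟫-stable (λ j n → + j ℤ.* r j n)))))
        where
        open Integrality K
        open CharacterRing K char₁ char₂
        open _≅_[_] ad≅1 renaming (quotient to b; equation to ad≡1+bm)
        ⟪⟫-stable : ∀ z → Stable ⟪ z ⟫
        ⟪⟫-stable z = sumK-stable (upTo m) λ j →
          Stabilises-* generators (ψ₂-stable (+ j)) (moment-stable char₁ ψ₁-stable q₁ (z j))
        u : ℤ
        -- m occurs only squared in m² S, so the relation a d - b m = 1 is squared; `u` a collects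
        -- the terms of the square that contain a.
        u = d ℤ.* (a ℤ.* d ℤ.- + 2 ℤ.* b ℤ.* + m)
        -- The square of a d − b m = 1.
        bezout : u ℤ.* a ℤ.+ b ℤ.* b ℤ.* (+ m ℤ.* + m) ≡ + 1
        bezout = ≡.trans (lemma a b d (+ m)) (≡.cong (λ z → z ℤ.* z) (≡.trans (≡.cong (λ z → z ℤ.- b ℤ.* + m) ad≡1+bm) (lemma′ (b ℤ.* + m))))
          where
          lemma : ∀ a b d m → d ℤ.* (a ℤ.* d ℤ.- + 2 ℤ.* b ℤ.* m) ℤ.* a ℤ.+ b ℤ.* b ℤ.* (m ℤ.* m)
            ≡ (a ℤ.* d ℤ.- b ℤ.* m) ℤ.* (a ℤ.* d ℤ.- b ℤ.* m)
          lemma = solve-∀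
          lemma′ : ∀ z → + 1 ℤ.+ z ℤ.- z ≡ + 1
          lemma′ = solve-∀
        combination : κ u * (κ a * S) + κ (b ℤ.* b) * (κ (+ m ℤ.* + m) * S) ≈ S
        combination = begin
          κ u * (κ a * S) + κ (b ℤ.* b) * (κ (+ m ℤ.* + m) * S)
            ≈⟨ solve 5 (λ u a b m s → u :* (a :* s) :+ b :* (m :* s) := (u :* a :+ b :* m) :* s) refl
                 (κ u) (κ a) (κ (b ℤ.* b)) (κ (+ m ℤ.* + m)) S ⟩
          (κ u * κ a + κ (b ℤ.* b) * κ (+ m ℤ.* + m)) * S
            ≈⟨ *-congʳ (trans (+-cong (sym (κ-* u a)) (sym (κ-* (b ℤ.* b) (+ m ℤ.* + m)))) (sym (κ-+ (u ℤ.* a) (b ℤ.* b ℤ.* (+ m ℤ.* + m))))) ⟩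
          κ (u ℤ.* a ℤ.+ b ℤ.* b ℤ.* (+ m ℤ.* + m)) * S
            ≈⟨ *-congʳ (trans (reflexive (≡.cong κ bezout)) κ-1) ⟩
          1# * S
            ≈⟨ *-identityˡ S ⟩
          S ∎

    unit-eigen : d ≅ + 1 [ q₂ ] → ψ₂ d * ψ₂.moment m (+_) ≈ κ (+ 1) * ψ₂.moment m (+_)
    unit-eigen d≅1 = *-congʳ (trans (ψ₂.periodic d≅1) (trans ψ₂.one (sym κ-1)))

    -- Reflection turns the weight j into m - j, and the constant m sums to 0; hence ψ₂(-1) acts as
    -- -1 on the first moment for either parity of ψ₂.
    neg-unit-eigen : d ≅ -[1+ 0 ] [ q₂ ] → ψ₂ d * ψ₂.moment m (+_) ≈ κ -[1+ 0 ] * ψ₂.moment m (+_)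
    neg-unit-eigen d≅-1 = begin
      ψ₂ d * ψ₂.moment m (+_)
        ≈⟨ *-congʳ (ψ₂.periodic d≅-1) ⟩
      ψ₂ -[1+ 0 ] * ψ₂.moment m (+_)
        ≈⟨ ψ₂.reflect m (q₁ ℕ.* t) m≡[q₁t]q₂ (κ ∘ (+_)) ⟨
      ∑ m (λ j → ψ₂ (+ j) * κ (+ neg m j))
        ≈⟨ ∑-cong m (λ { zero _ → trans (trans (*-congʳ ψ₂.at-zero) (zeroˡ _)) (sym (trans (*-congʳ ψ₂.at-zero) (zeroˡ _)))
                       ; (suc j) j<m → *-congˡ (reflexive (≡.cong κ (≡.trans (neg-pos m j<m) (lemma (+ m) (+ suc j))))) }) ⟩
      ψ₂.moment m (λ j → + m ℤ.+ -[1+ 0 ] ℤ.* + j)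
        ≈⟨ ψ₂.moment-+ m (λ _ → + m) (λ j → -[1+ 0 ] ℤ.* + j) ⟩
      ψ₂.moment m (λ _ → + m) + ψ₂.moment m (λ j → -[1+ 0 ] ℤ.* + j)
        ≈⟨ trans (+-cong (moment₂-const (+ m)) (ψ₂.moment-*ˡ m -[1+ 0 ] (+_))) (+-identityˡ _) ⟩
      κ -[1+ 0 ] * ψ₂.moment m (+_) ∎
      where
      lemma : ∀ m j → m ℤ.- j ≡ m ℤ.+ -[1+ 0 ] ℤ.* j
      lemma = solve-∀

theorem1p6 : ∀ {c ℓ : Level} (K : Char0Field c ℓ) →
    let open Char0Field K
        open CommutativeRing cring
    in ∀ (q1 q2 : ℕ) (χ1 χ2 : ℤ → Carrier) →
      IsDirichletChar K q1 χ1 → IsPrimitive K q1 χ1 → IsNontrivial K q1 χ1 →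
      IsDirichletChar K q2 χ2 → IsPrimitive K q2 χ2 → IsNontrivial K q2 χ2 →
      (χ1 -[1+ 0 ] * χ2 -[1+ 0 ]) ≈ 1# →
      ∀ (a b c' d : ℤ) → InΓ₁ (q1 ℕ.* q2) a b c' d →
      IsAlgebraicInteger K (fromℕ cring (gcd q1 q2) * Sγ K q1 q2 χ1 χ2 a b c' d)
theorem1p6 K q1 q2 χ1 χ2 isChar₁ _ nontrivial₁ isChar₂ _ nontrivial₂ parity a b c' d (det , N∣c , N∣a-1 , N∣d-1) =
  by-sign c' det N∣c
  where
  open Char0Field K
  open CommutativeRing cring
  open IntegerEmbedding cring
  open Characters K
  module χ̄₁ = Conjugate isChar₁
  module χ̄₂ = Conjugate isChar₂

  instance
    q1≢0 : ℕ.NonZero q1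
    q1≢0 = ℕ.>-nonZero (IsDirichletChar.modulus-pos isChar₁)
    q2≢0 : ℕ.NonZero q2
    q2≢0 = ℕ.>-nonZero (IsDirichletChar.modulus-pos isChar₂)

  char₁ : Character q1 χ̄₁.ψ
  char₁ = χ̄₁.isCharacter nontrivial₁
  char₂ : Character q2 χ̄₂.ψ
  char₂ = χ̄₂.isCharacter nontrivial₂

  even : χ̄₁.ψ -[1+ 0 ] * χ̄₂.ψ -[1+ 0 ] ≈ 1#
  even = inverse-unique refl (trans (*-congʳ (sym parity)) (χ̄₁.units-* χ̄₁.conj-minus-one χ̄₂.conj-minus-one)) (*-identityˡ 1#)

  N : ℤ
  N = + (q1 ℕ.* q2)

  1+multiple : ∀ {y} → Signed._∣_ N (y ℤ.- + 1) → ∃ λ s → y ≡ + 1 ℤ.+ + q1 ℤ.* + q2 ℤ.* s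
  1+multiple {y} (Signed.divides s eq) = s , ≡.trans (lemma y)
    (≡.cong (λ z → + 1 ℤ.+ z) (≡.trans eq (≡.trans (ℤ.*-comm s N) (≡.cong (λ z → z ℤ.* s) (ℤ.pos-* q1 q2)))))
    where
    lemma : ∀ y → y ≡ + 1 ℤ.+ (y ℤ.- + 1)
    lemma = solve-∀

  a-witness : ∃ λ s → a ≡ + 1 ℤ.+ + q1 ℤ.* + q2 ℤ.* s
  a-witness = 1+multiple (Signed.∣ᵤ⇒∣ N∣a-1)

  d≅1 : d ≅ + 1 [ q2 ]
  d≅1 = let s , eq = 1+multiple (Signed.∣ᵤ⇒∣ N∣d-1) in + q1 ℤ.* s , ≡.trans eq (lemma (+ q1) (+ q2) s)
    where
    lemma : ∀ q₁ q₂ s → + 1 ℤ.+ q₁ ℤ.* q₂ ℤ.* s ≡ + 1 ℤ.+ q₁ ℤ.* s ℤ.* q₂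
    lemma = solve-∀

  det′ : ∀ {y} → a ℤ.* d ℤ.- b ℤ.* y ≡ + 1 → a ℤ.* d ≡ + 1 ℤ.+ b ℤ.* y
  det′ {y} eq = ≡.trans (lemma (a ℤ.* d) (b ℤ.* y)) (≡.cong (λ z → z ℤ.+ b ℤ.* y) eq)
    where
    lemma : ∀ u v → u ≡ u ℤ.- v ℤ.+ v
    lemma = solve-∀

  conclude : ∀ {y} → CharacterRing.Stable K char₁ char₂ y → IsAlgebraicInteger K (fromℕ cring (gcd q1 q2) * y)
  conclude st = CharacterRing.stable⇒integral K char₁ char₂
    (Integrality.Stabilises-* K _ (Integrality.Stabilises-κ K _ (+ gcd q1 q2)) st)

  factor : ∀ k → (q1 ℕ.* q2) ℕ.∣ k → ∃ λ t → k ≡ q1 ℕ.* (q2 ℕ.* t)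
  factor k (ℕ.divides t eq) = t , ≡.trans eq (≡.trans (ℕ.*-comm t (q1 ℕ.* q2)) (ℕ.*-assoc q1 q2 t))

  positive : ∀ k .{{_ : ℕ.NonZero k}} → (∃ λ t → k ≡ q1 ℕ.* (q2 ℕ.* t)) → a ℤ.* d ≡ + 1 ℤ.+ b ℤ.* + k →
    CharacterRing.Stable K char₁ char₂ (Sac K q1 q2 χ1 χ2 a k)
  -- Matching on `refl` makes the modulus literally q₁ (q₂ t), so `Sac` and the sum `S` coincide
  -- without transport.
  positive _ (t , ≡.refl) ad≡1+bk = S-stable even (+ 1) (proj₁ a-witness) (proj₂ a-witness) (unit-eigen even d≅1)
    where
    open DedekindSum K char₁ char₂ t a d (b , ad≡1+bk)

  -- For a negative lower-left entry the sum is that of -γ, with entries -a, -b and -d; its diagonal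
  -- is -1 modulo q₁ q₂, whence the sign -1.
  negative : ∀ k .{{_ : ℕ.NonZero k}} → (∃ λ t → k ≡ q1 ℕ.* (q2 ℕ.* t)) → a ℤ.* d ≡ + 1 ℤ.+ b ℤ.* ℤ.- + k →
    CharacterRing.Stable K char₁ char₂ (Sac K q1 q2 χ1 χ2 (ℤ.- a) k)
  negative k (t , ≡.refl) ad≡1-bk =
    S-stable even -[1+ 0 ] (ℤ.- proj₁ a-witness) -a≡ (neg-unit-eigen even (≅-neg d≅1))
    where
    lemma : ∀ a d → ℤ.- a ℤ.* ℤ.- d ≡ a ℤ.* d
    lemma = solve-∀
    lemma′ : ∀ b k → + 1 ℤ.+ b ℤ.* ℤ.- k ≡ + 1 ℤ.+ ℤ.- b ℤ.* k
    lemma′ = solve-∀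
    lemma″ : ∀ q₁ q₂ s → ℤ.- (+ 1 ℤ.+ q₁ ℤ.* q₂ ℤ.* s) ≡ -[1+ 0 ] ℤ.+ q₁ ℤ.* q₂ ℤ.* ℤ.- s
    lemma″ = solve-∀
    -a≡ : ℤ.- a ≡ -[1+ 0 ] ℤ.+ + q1 ℤ.* + q2 ℤ.* ℤ.- proj₁ a-witness
    -a≡ = ≡.trans (≡.cong ℤ.-_ (proj₂ a-witness)) (lemma″ (+ q1) (+ q2) (proj₁ a-witness))
    open DedekindSum K char₁ char₂ t (ℤ.- a) (ℤ.- d)
      (ℤ.- b , ≡.trans (lemma a d) (≡.trans ad≡1-bk (lemma′ b (+ k))))

  by-sign : ∀ e → a ℤ.* d ℤ.- b ℤ.* e ≡ + 1 → (q1 ℕ.* q2) ℕ.∣ ∣ e ∣ →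
    IsAlgebraicInteger K (fromℕ cring (gcd q1 q2) * Sγ K q1 q2 χ1 χ2 a b e d)
  by-sign (+ zero)  eq N∣e = conclude (Integrality.Stabilises-κ K _ (+ 0))
  by-sign (+ suc k) eq N∣e = conclude (positive (suc k) (factor (suc k) N∣e) (det′ eq))
  by-sign -[1+ k ]  eq N∣e = conclude (negative (suc k) (factor (suc k) N∣e) (det′ eq))
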